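{- Let $n\ge1$ and $d\ge2$ be integers, $d_0=\gcd(n,d)$ and $n_1=n/d_0$. (i) The kernel of multiplication by $d$ on $\Sigma(n,d)$ is isomorphic to $\mathbb{Z}_d^{\,n-n_1}$. (ii) The kernel of multiplication by $d$ on $S(n,d)$ is isomorphic to $\mathbb{Z}_{d/d_0}\oplus\mathbb{Z}_d^{\,n-n_1-1}$.
   Context: In $\mathbb{Q}[x]/(x^n-1)$ (exponents mod $n$) put $e_v=x^v-1$, $\epsilon_v=d\,e_v-e_{dv}$; $\mathcal Z_n$ = $\mathbb{Z}$-span of $e_1,\dots,e_{n-1}$, $\mathcal E_{n,d}$ = $\mathbb{Z}$-span of $\epsilon_1,\dots,\epsilon_{n-1}$, $\Sigma(n,d)=\mathcal Z_n/\mathcal E_{n,d}$. With $f_v=dx^v-\sum_{i=0}^{d-1}x^{dv+i}$, $S(n,d)=\mathcal Z_n/\langle f_1,\dots,f_{n-1}\rangle_{\mathbb{Z}}$ (the sandpile group of the generalized de Bruijn graph $\mathrm{DB}(n,d)$).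
   Formalization: In (ii), if gcd(n,d)=1 then n−n₁−1=−1 and the stated group is undefined; there the claim is read as "the kernel is trivial", and the displayed isomorphism is claimed for gcd(n,d)>1. -}

module Defs where

open import Data.Nat as ℕ using (ℕ; zero; suc; _∸_; NonZero)
open import Data.Nat.DivMod using (_mod_)
open import Data.Integer as ℤ using (ℤ; +_; 0ℤ; 1ℤ; _-_)
open import Data.Integer.Divisibility using (_∣_)
open import Data.Fin as Fin using (Fin)
open import Data.Product using (Σ; _×_; ∃)
open import Relation.Nullary using (yes; no)
open import Relation.Binary.PropositionalEquality using (_≡_)

-- An element of ℚ[x]/(x^n - 1) with integer coefficients, as its
-- coefficient vector: p i = coefficient of x^i  (i = 0 … n-1).
Poly : ℕ → Set
Poly n = Fin n → ℤ

module _ {n : ℕ} where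
  infixl 6 _⊕_ _⊖_
  infixl 7 _·_

  _⊕_ : Poly n → Poly n → Poly n
  (p ⊕ q) i = p i ℤ.+ q i

  _⊖_ : Poly n → Poly n → Poly n
  (p ⊖ q) i = p i - q i

  _·_ : ℤ → Poly n → Poly n
  (k · p) i = k ℤ.* p i

  zeroP : Poly n
  zeroP i = 0ℤ

  sumP : ℕ → (ℕ → Poly n) → Poly n
  sumP zero    g = zeroP
  sumP (suc k) g = sumP k g ⊕ g k

mono : (n : ℕ) .{{_ : NonZero n}} → ℕ → Poly n
mono n v i with i Fin.≟ (v mod n)
... | yes _ = 1ℤ
... | no  _ = 0ℤ

e : (n : ℕ) .{{_ : NonZero n}} → ℕ → Poly n
e n v = mono n v ⊖ mono n 0

ε : (n : ℕ) .{{_ : NonZero n}} → ℕ → ℕ → Poly n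
ε n d v = (+ d) · e n v ⊖ e n (d ℕ.* v)

f : (n : ℕ) .{{_ : NonZero n}} → ℕ → ℕ → Poly n
f n d v = (+ d) · mono n v ⊖ sumP d (λ i → mono n (d ℕ.* v ℕ.+ i))

InSpan : (n : ℕ) → (ℕ → Poly n) → Poly n → Set
InSpan n g a =
  Σ (ℕ → ℤ) λ c → ∀ i → a i ≡ sumP (n ∸ 1) (λ j → c (suc j) · g (suc j)) i

InZ : (n : ℕ) .{{_ : NonZero n}} → Poly n → Set
InZ n = InSpan n (e n)

CongMod : {r : ℕ} → (Fin r → ℕ) → (Fin r → ℤ) → (Fin r → ℤ) → Set
CongMod m x y = ∀ i → (+ m i) ∣ (x i - y i)

addV : {r : ℕ} → (Fin r → ℤ) → (Fin r → ℤ) → (Fin r → ℤ)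
addV x y i = x i ℤ.+ y i

-- A group isomorphism  ⊕_{i<r} ℤ_{m i}  ≅  ker( d· : 𝒵_n / L → 𝒵_n / L ),
-- where L = ℤ-span of g_1, …, g_{n-1} (⊆ 𝒵_n).
-- The quotient is presented as the setoid 𝒵_n with a ~ b ⇔ a - b ∈ L;
-- the kernel consists of classes of a ∈ 𝒵_n with d a ∈ L.
-- φ is given on representatives; the fields say it is well defined,
-- lands in the kernel, is additive, injective and surjective.
record KerIso (n : ℕ) .{{_ : NonZero n}} (d : ℕ) (g : ℕ → Poly n)
              (r : ℕ) (m : Fin r → ℕ) : Set where
  field
    φ        : (Fin r → ℤ) → Poly n
    φ-inZ    : ∀ x → InZ n (φ x)
    φ-inKer  : ∀ x → InSpan n g ((+ d) · φ x)
    φ-wd     : ∀ x y → CongMod m x y → InSpan n g (φ x ⊖ φ y)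
    φ-hom    : ∀ x y → InSpan n g (φ (addV x y) ⊖ (φ x ⊕ φ y))
    φ-inj    : ∀ x y → InSpan n g (φ x ⊖ φ y) → CongMod m x y
    φ-surj   : ∀ a → InZ n a → InSpan n g ((+ d) · a) →
               ∃ λ x → InSpan n g (a ⊖ φ x)

constMod : (r d : ℕ) → Fin r → ℕ
constMod r d _ = d

firstMod : (a d k : ℕ) → Fin (suc k) → ℕ
firstMod a d k Fin.zero    = a
firstMod a d k (Fin.suc _) = d

{-# OPTIONS --safe #-}
module Submission where

{-
Let T : x^v ↦ x^{dv}, U : x^v ↦ Σ_{j<d} x^{dv+j} and R : x^v ↦ x^{v mod n₁}. The ε_v span (d - T)𝒵_n and,
since U𝟏 = d𝟏 for the all-ones vector 𝟏, the f_v span (d - U)ℤ^n. T does not increase the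
ℓ¹-norm and d ≥ 2, so d - T is injective; from (x - 1)U = T(x - 1) the kernel
of d - U consists of the constants. Because TR = T and UR = U, every φ y = b - R b is killed by T and by U,
hence d φ y = (d - T)φ y = (d - U)φ y, and it remains to see which φ y already lie in the lattice and that
they exhaust the kernel. If d a = (d - T)b then d divides T b, hence R b, and a ≡ φ y. If d a = (d - U)b then
d divides T(x - 1)b, so R b ≡ c P modulo d with P = Σ_{i<n₁} x^i, and U P = d₁ 𝟏 forces g = gcd(n, d) to
divide c; as g P - 𝟏 is again a value of φ, a ≡ φ y once more.
-}

open import Algebra.Properties.Semiring.Sum as SemiringSum using ()
open import Data.Fin as Fin using (Fin; toℕ)
open import Data.Fin.Properties using (toℕ<n; toℕ-fromℕ<; toℕ-injective; toℕ-fromℕ; toℕ-inject₁)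
open import Data.Integer as ℤ using (ℤ; +_; 0ℤ; 1ℤ; _-_)
import Data.Integer.Properties as ℤₚ
import Data.Integer.Divisibility.Signed as ∣ₛ
open ∣ₛ using (divides) renaming (_∣_ to _∣ₛ_)
open import Data.Integer.Tactic.RingSolver using (solve-∀)
open import Data.Nat using
  (ℕ; zero; suc; _+_; _*_; _∸_; _≤_; _<_; z≤n; s≤s; _%_; _/_; NonZero; ≢-nonZero; ≢-nonZero⁻¹; >-nonZero)
open import Data.Nat.Coprimality using (Coprime; coprime-divisor; gcd≡1⇒coprime)
open import Data.Nat.DivMod
open import Data.Nat.Divisibility using (_∣_; m%n≡0⇒n∣m; *-cancelʳ-∣; m∣m*n)
open import Data.Nat.GCD using (gcd; c*gcd[m,n]≡gcd[cm,cn])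
import Data.Nat.Properties as ℕₚ
open import Data.Product using (∃; _×_; _,_; proj₁; proj₂)
open import Data.Sum using (inj₁; inj₂)
open import Function using (_∘_; case_of_)
open import Relation.Binary.PropositionalEquality
open import Relation.Nullary using (yes; no; contradiction)
open import Defs

open SemiringSum (ℤₚ.+-*-semiring)
open ≡-Reasoning

-- Finite sums of integers.

sum-single : ∀ {n} (k : Fin n) (t : Fin n → ℤ) → (∀ j → j ≢ k → t j ≡ 0ℤ) → sum t ≡ t k
sum-single {suc n} Fin.zero t z = begin
  t Fin.zero ℤ.+ sum (t ∘ Fin.suc)
    ≡⟨ cong (λ s → t Fin.zero ℤ.+ s)
         (trans (sum-cong-≗ (λ j → z (Fin.suc j) λ ())) (sum-replicate-zero n)) ⟩
  t Fin.zero ℤ.+ 0ℤ ≡⟨ ℤₚ.+-identityʳ _ ⟩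
  t Fin.zero ∎
sum-single (Fin.suc k) t z = begin
  t Fin.zero ℤ.+ sum (t ∘ Fin.suc)
    ≡⟨ cong₂ ℤ._+_ (z Fin.zero λ ())
         (sum-single k (t ∘ Fin.suc) λ j j≢k → z (Fin.suc j) λ { refl → j≢k refl }) ⟩
  0ℤ ℤ.+ t (Fin.suc k) ≡⟨ ℤₚ.+-identityˡ _ ⟩
  t (Fin.suc k) ∎

sum-mono-≤ : ∀ {n} {s t : Fin n → ℤ} → (∀ i → s i ℤ.≤ t i) → sum s ℤ.≤ sum t
sum-mono-≤ {zero}  s≤t = ℤₚ.≤-refl
sum-mono-≤ {suc n} s≤t = ℤₚ.+-mono-≤ (s≤t Fin.zero) (sum-mono-≤ (s≤t ∘ Fin.suc))

∣sum∣≤sum∣∣ : ∀ {n} (t : Fin n → ℤ) → + ℤ.∣ sum t ∣ ℤ.≤ sum (λ i → + ℤ.∣ t i ∣)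
∣sum∣≤sum∣∣ {zero}  t = ℤₚ.≤-refl
∣sum∣≤sum∣∣ {suc n} t = ℤₚ.≤-trans
  (ℤ.+≤+ (ℤₚ.∣i+j∣≤∣i∣+∣j∣ (t Fin.zero) (sum (t ∘ Fin.suc))))
  (ℤₚ.+-monoʳ-≤ (+ ℤ.∣ t Fin.zero ∣) (∣sum∣≤sum∣∣ (t ∘ Fin.suc)))

sum-∣∣-nonneg : ∀ {n} (t : Fin n → ℤ) → 0ℤ ℤ.≤ sum (λ i → + ℤ.∣ t i ∣)
sum-∣∣-nonneg t = ℤₚ.≤-trans (ℤ.+≤+ z≤n) (∣sum∣≤sum∣∣ t)

∣term∣≤sum : ∀ {n} (t : Fin n → ℤ) k → + ℤ.∣ t k ∣ ℤ.≤ sum (λ i → + ℤ.∣ t i ∣)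
∣term∣≤sum t Fin.zero = ℤₚ.≤-trans (ℤₚ.≤-reflexive (sym (ℤₚ.+-identityʳ _)))
  (ℤₚ.+-monoʳ-≤ (+ ℤ.∣ t Fin.zero ∣) (sum-∣∣-nonneg (t ∘ Fin.suc)))
∣term∣≤sum t (Fin.suc k) = ℤₚ.≤-trans (∣term∣≤sum (t ∘ Fin.suc) k)
  (ℤₚ.≤-trans (ℤₚ.≤-reflexive (sym (ℤₚ.+-identityˡ _)))
    (ℤₚ.+-monoˡ-≤ (sum (λ i → + ℤ.∣ t (Fin.suc i) ∣)) (ℤ.+≤+ (z≤n {ℤ.∣ t Fin.zero ∣}))))

sum-- : ∀ {n} (s t : Fin n → ℤ) → sum (λ i → s i - t i) ≡ sum s - sum t
sum-- s t = begin
  sum (λ i → s i - t i)          ≡⟨ sum-cong-≗ (λ i → cong (λ z → s i ℤ.+ z) (sym (ℤₚ.-1*i≡-i (t i)))) ⟩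
  sum (λ i → s i ℤ.+ ℤ.-1ℤ ℤ.* t i) ≡⟨ ∑-distrib-+ s _ ⟩
  sum s ℤ.+ sum (λ i → ℤ.-1ℤ ℤ.* t i) ≡⟨ cong (λ z → sum s ℤ.+ z) (sym (*-distribˡ-sum ℤ.-1ℤ t)) ⟩
  sum s ℤ.+ ℤ.-1ℤ ℤ.* sum t      ≡⟨ cong (λ z → sum s ℤ.+ z) (ℤₚ.-1*i≡-i _) ⟩
  sum s - sum t ∎

-- Sums over initial segments of the natural numbers.

rangeSum : ℕ → (ℕ → ℤ) → ℤ
rangeSum zero    h = 0ℤ
rangeSum (suc k) h = rangeSum k h ℤ.+ h k

rangeSum-cong : ∀ k {h h′ : ℕ → ℤ} → (∀ j → h j ≡ h′ j) → rangeSum k h ≡ rangeSum k h′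
rangeSum-cong zero    eq = refl
rangeSum-cong (suc k) eq = cong₂ ℤ._+_ (rangeSum-cong k eq) (eq k)

rangeSum-const : ∀ k c → rangeSum k (λ _ → c) ≡ + k ℤ.* c
rangeSum-const zero    c = sym (ℤₚ.*-zeroˡ c)
rangeSum-const (suc k) c = trans (cong (ℤ._+ c) (rangeSum-const k c)) (lemma (+ k) c)
  where
  lemma : ∀ m c → m ℤ.* c ℤ.+ c ≡ (1ℤ ℤ.+ m) ℤ.* c
  lemma = solve-∀

rangeSum-+ : ∀ a b h → rangeSum (a + b) h ≡ rangeSum a h ℤ.+ rangeSum b (λ j → h (a + j))
rangeSum-+ a zero h = trans (cong (λ k → rangeSum k h) (ℕₚ.+-identityʳ a)) (sym (ℤₚ.+-identityʳ _))
rangeSum-+ a (suc b) h = begin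
  rangeSum (a + suc b) h ≡⟨ cong (λ k → rangeSum k h) (ℕₚ.+-suc a b) ⟩
  rangeSum (a + b) h ℤ.+ h (a + b) ≡⟨ cong (ℤ._+ h (a + b)) (rangeSum-+ a b h) ⟩
  rangeSum a h ℤ.+ rangeSum b (λ j → h (a + j)) ℤ.+ h (a + b) ≡⟨ ℤₚ.+-assoc (rangeSum a h) _ _ ⟩
  rangeSum a h ℤ.+ (rangeSum b (λ j → h (a + j)) ℤ.+ h (a + b)) ∎

-- Division with remainder by `b` writes each index below `a * b` as `b * v + j`. The values at
-- constant polynomials come from regrouping with this.
rangeSum-* : ∀ a b h → rangeSum (a * b) h ≡ rangeSum a (λ v → rangeSum b (λ j → h (b * v + j)))
rangeSum-* zero b h = refl
rangeSum-* (suc a) b h = begin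
  rangeSum (b + a * b) h ≡⟨ cong (λ k → rangeSum k h) (ℕₚ.+-comm b (a * b)) ⟩
  rangeSum (a * b + b) h ≡⟨ rangeSum-+ (a * b) b h ⟩
  rangeSum (a * b) h ℤ.+ rangeSum b (λ j → h (a * b + j))
    ≡⟨ cong₂ ℤ._+_ (rangeSum-* a b h)
         (rangeSum-cong b (λ j → cong (λ k → h (k + j)) (ℕₚ.*-comm a b))) ⟩
  rangeSum a (λ v → rangeSum b (λ j → h (b * v + j))) ℤ.+ rangeSum b (λ j → h (b * a + j)) ∎

-- `sum` peels off the first term and `rangeSum` the last, so the induction has to split `sum` at
-- its end.
sum-toℕ : ∀ k h → ∑[ i < k ] h (toℕ i) ≡ rangeSum k h
sum-toℕ zero h = refl
sum-toℕ (suc k) h = begin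
  ∑[ i < suc k ] h (toℕ i) ≡⟨ sum-init-last {k} (λ i → h (toℕ i)) ⟩
  ∑[ i < k ] h (toℕ (Fin.inject₁ i)) ℤ.+ h (toℕ (Fin.fromℕ k))
    ≡⟨ cong₂ ℤ._+_ (sum-cong-≗ {k} (λ i → cong h (toℕ-inject₁ i))) (cong h (toℕ-fromℕ k)) ⟩
  ∑[ i < k ] h (toℕ i) ℤ.+ h k ≡⟨ cong (ℤ._+ h k) (sum-toℕ k h) ⟩
  rangeSum k h ℤ.+ h k ∎

sumP-at : ∀ {n} k (g : ℕ → Poly n) i → sumP k g i ≡ rangeSum k (λ j → g j i)
sumP-at zero    g i = refl
sumP-at (suc k) g i = cong (ℤ._+ g k i) (sumP-at k g i)

sumP-cong : ∀ {n} k {g h : ℕ → Poly n} → (∀ j → g j ≗ h j) → sumP k g ≗ sumP k h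
sumP-cong k {g} {h} eq i =
  trans (sumP-at k g i) (trans (rangeSum-cong k (λ j → eq j i)) (sym (sumP-at k h i)))

-- Residues modulo n and coefficients of monomials.

module _ (n : ℕ) .{{_ : NonZero n}} where

  %-congˡ-+ : ∀ c {a b} → a % n ≡ b % n → (c + a) % n ≡ (c + b) % n
  %-congˡ-+ c {a} {b} eq = trans (%-distribˡ-+ c a n)
    (trans (cong (λ z → (c % n + z) % n) eq) (sym (%-distribˡ-+ c b n)))

  -- Adding `c * (n ∸ 1)` turns `c + a` into `a + c * n`, so this multiple of `c` serves as the
  -- negative of `c` modulo n.
  %-cancelˡ-+ : ∀ c {a b} → (c + a) % n ≡ (c + b) % n → a % n ≡ b % n
  %-cancelˡ-+ c {a} {b} eq =
    trans (sym (reduce a)) (trans (%-congˡ-+ (c * (n ∸ 1)) eq) (reduce b))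
    where
    1≤n : 1 ≤ n
    1≤n = ℕₚ.n≢0⇒n>0 (≢-nonZero⁻¹ n)
    reduce : ∀ a → (c * (n ∸ 1) + (c + a)) % n ≡ a % n
    reduce a = trans (%-congˡ (begin
      c * (n ∸ 1) + (c + a) ≡⟨ sym (ℕₚ.+-assoc (c * (n ∸ 1)) c a) ⟩
      c * (n ∸ 1) + c + a   ≡⟨ cong (_+ a) (trans (ℕₚ.+-comm _ c) (sym (ℕₚ.*-suc c (n ∸ 1)))) ⟩
      c * suc (n ∸ 1) + a   ≡⟨ cong (λ k → c * k + a) (ℕₚ.m+[n∸m]≡n 1≤n) ⟩
      c * n + a             ≡⟨ ℕₚ.+-comm (c * n) a ⟩
      a + c * n             ∎)) ([m+kn]%n≡m%n a c n)

  %-congˡ-* : ∀ c {a b} → a % n ≡ b % n → (c * a) % n ≡ (c * b) % n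
  %-congˡ-* c {a} {b} eq = trans (%-distribˡ-* c a n)
    (trans (cong (λ z → (c % n * z) % n) eq) (sym (%-distribˡ-* c b n)))

  toℕ-mod : ∀ v → toℕ (v mod n) ≡ v % n
  toℕ-mod v = toℕ-fromℕ< (m%n<n v n)

  toℕ-% : ∀ (i : Fin n) → toℕ i % n ≡ toℕ i
  toℕ-% i = m<n⇒m%n≡m (toℕ<n i)

  mod-toℕ : ∀ (i : Fin n) → toℕ i mod n ≡ i
  mod-toℕ i = toℕ-injective (trans (toℕ-mod (toℕ i)) (toℕ-% i))

  mono-≡ : ∀ {v i} → toℕ i ≡ v % n → mono n v i ≡ 1ℤ
  mono-≡ {v} {i} eq with i Fin.≟ (v mod n)
  ... | yes _ = refl
  ... | no i≢ = contradiction (toℕ-injective (trans eq (sym (toℕ-mod v)))) i≢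

  mono-≢ : ∀ {v i} → toℕ i ≢ v % n → mono n v i ≡ 0ℤ
  mono-≢ {v} {i} ne with i Fin.≟ (v mod n)
  ... | yes refl = contradiction (toℕ-mod v) ne
  ... | no _ = refl

  mono-≡-mono : ∀ {v w i j} → (toℕ i ≡ v % n → toℕ j ≡ w % n) → (toℕ j ≡ w % n → toℕ i ≡ v % n) →
                mono n v i ≡ mono n w j
  mono-≡-mono {v} {w} {i} {j} to from with toℕ i ℕₚ.≟ v % n
  ... | yes eq = trans (mono-≡ eq) (sym (mono-≡ (to eq)))
  ... | no ne  = trans (mono-≢ ne) (sym (mono-≢ (ne ∘ from)))

  mono-cong-% : ∀ {v w} → v % n ≡ w % n → mono n v ≗ mono n w
  mono-cong-% {v} {w} eq i = mono-≡-mono {v} {w} (λ p → trans p eq) (λ p → trans p (sym eq))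

  mono-shift : ∀ c v w → mono n (c + v) ((c + w) mod n) ≡ mono n v (w mod n)
  mono-shift c v w = mono-≡-mono {c + v} {v}
    (λ p → trans (toℕ-mod w) (%-cancelˡ-+ c (trans (sym (toℕ-mod (c + w))) p)))
    (λ p → trans (toℕ-mod (c + w)) (%-congˡ-+ c (trans (sym (toℕ-mod w)) p)))

  sum-mono : ∀ v → sum (mono n v) ≡ 1ℤ
  sum-mono v = trans
    (sum-single (v mod n) (mono n v)
      (λ j j≢ → mono-≢ (λ eq → j≢ (toℕ-injective (trans eq (sym (toℕ-mod v)))))))
    (mono-≡ (toℕ-mod v))

  ∣mono∣ : ∀ v i → + ℤ.∣ mono n v i ∣ ≡ mono n v i
  ∣mono∣ v i with i Fin.≟ (v mod n)
  ... | yes _ = refl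
  ... | no _ = refl

  -- Linear maps given by the images of the monomials.

  𝟏 : Poly n
  𝟏 _ = 1ℤ

  -- The family is indexed by ℕ, as the generators of the lattices are, but only its values below n
  -- enter. Its image is the span of these values.
  Lin : (ℕ → Poly n) → Poly n → Poly n
  Lin g p i = ∑[ v < n ] (p v ℤ.* g (toℕ v) i)

  Lin-cong : ∀ g {p q} → p ≗ q → Lin g p ≗ Lin g q
  Lin-cong g eq i = sum-cong-≗ (λ v → cong (ℤ._* g (toℕ v) i) (eq v))

  Lin-congˡ : ∀ {g h} p → (∀ v → g v ≗ h v) → Lin g p ≗ Lin h p
  Lin-congˡ p eq i = sum-cong-≗ (λ v → cong (p v ℤ.*_) (eq (toℕ v) i))

  Lin-⊕ : ∀ g p q → Lin g (p ⊕ q) ≗ Lin g p ⊕ Lin g q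
  Lin-⊕ g p q i = trans
    (sum-cong-≗ (λ v → ℤₚ.*-distribʳ-+ (g (toℕ v) i) (p v) (q v)))
    (∑-distrib-+ (λ v → p v ℤ.* g (toℕ v) i) (λ v → q v ℤ.* g (toℕ v) i))

  Lin-⊖ : ∀ g p q → Lin g (p ⊖ q) ≗ Lin g p ⊖ Lin g q
  Lin-⊖ g p q i = trans
    (sum-cong-≗ (λ v → lemma (g (toℕ v) i) (p v) (q v)))
    (sum-- (λ v → p v ℤ.* g (toℕ v) i) (λ v → q v ℤ.* g (toℕ v) i))
    where
    lemma : ∀ x a b → (a - b) ℤ.* x ≡ a ℤ.* x - b ℤ.* x
    lemma = solve-∀

  Lin-· : ∀ g k p → Lin g (k · p) ≗ k · Lin g p
  Lin-· g k p i = trans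
    (sum-cong-≗ (λ v → ℤₚ.*-assoc k (p v) (g (toℕ v) i)))
    (sym (*-distribˡ-sum k (λ v → p v ℤ.* g (toℕ v) i)))

  Lin-zero : ∀ g → Lin g zeroP ≗ zeroP
  Lin-zero g i = Lin-· g 0ℤ zeroP i

  Linˡ-⊖ : ∀ g h p → Lin (λ v → g v ⊖ h v) p ≗ Lin g p ⊖ Lin h p
  Linˡ-⊖ g h p i = trans
    (sum-cong-≗ (λ v → lemma (p v) (g (toℕ v) i) (h (toℕ v) i)))
    (sum-- (λ v → p v ℤ.* g (toℕ v) i) (λ v → p v ℤ.* h (toℕ v) i))
    where
    lemma : ∀ x a b → x ℤ.* (a - b) ≡ x ℤ.* a - x ℤ.* b
    lemma = solve-∀

  Linˡ-· : ∀ k g p → Lin (λ v → k · g v) p ≗ k · Lin g p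
  Linˡ-· k g p i = trans
    (sum-cong-≗ (λ v → lemma (p v) k (g (toℕ v) i)))
    (sym (*-distribˡ-sum k (λ v → p v ℤ.* g (toℕ v) i)))
    where
    lemma : ∀ x k a → x ℤ.* (k ℤ.* a) ≡ k ℤ.* (x ℤ.* a)
    lemma = solve-∀

  Lin-const : ∀ g p → Lin (λ _ → g) p ≗ sum p · g
  Lin-const g p i = sym (*-distribʳ-sum (g i) p)

  Lin-∘ : ∀ g h p → Lin g (Lin h p) ≗ Lin (λ v → Lin g (h v)) p
  Lin-∘ g h p i = begin
    ∑[ w < n ] (∑[ v < n ] (p v ℤ.* h (toℕ v) w) ℤ.* g (toℕ w) i)
      ≡⟨ sum-cong-≗ (λ w → *-distribʳ-sum (g (toℕ w) i) (λ v → p v ℤ.* h (toℕ v) w)) ⟩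
    ∑[ w < n ] ∑[ v < n ] (p v ℤ.* h (toℕ v) w ℤ.* g (toℕ w) i)
      ≡⟨ ∑-comm (λ w v → p v ℤ.* h (toℕ v) w ℤ.* g (toℕ w) i) ⟩
    ∑[ v < n ] ∑[ w < n ] (p v ℤ.* h (toℕ v) w ℤ.* g (toℕ w) i)
      ≡⟨ sum-cong-≗ (λ v → trans
           (sum-cong-≗ (λ w → ℤₚ.*-assoc (p v) (h (toℕ v) w) (g (toℕ w) i)))
           (sym (*-distribˡ-sum (p v) (λ w → h (toℕ v) w ℤ.* g (toℕ w) i)))) ⟩
    ∑[ v < n ] (p v ℤ.* Lin g (h (toℕ v)) i) ∎

  -- The index on the right is reduced because `g` need not be periodic.
  Lin-mono : ∀ g v → Lin g (mono n v) ≗ g (v % n)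
  Lin-mono g v i = begin
    Lin g (mono n v) i
      ≡⟨ sum-single (v mod n) _ (λ j j≢ → trans
           (cong (ℤ._* g (toℕ j) i)
             (mono-≢ (λ eq → j≢ (toℕ-injective (trans eq (sym (toℕ-mod v)))))))
           (ℤₚ.*-zeroˡ (g (toℕ j) i))) ⟩
    mono n v (v mod n) ℤ.* g (toℕ (v mod n)) i
      ≡⟨ cong₂ (λ a w → a ℤ.* g w i) (mono-≡ (toℕ-mod v)) (toℕ-mod v) ⟩
    1ℤ ℤ.* g (v % n) i ≡⟨ ℤₚ.*-identityˡ _ ⟩
    g (v % n) i ∎

  Lin-id : ∀ p → Lin (mono n) p ≗ p
  Lin-id p i = begin
    Lin (mono n) p i
      ≡⟨ sum-single i _ (λ j j≢ → trans
           (cong (p j ℤ.*_) (mono-≢ (λ eq → j≢ (toℕ-injective (sym (trans eq (toℕ-% j)))))))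
           (ℤₚ.*-zeroʳ (p j))) ⟩
    p i ℤ.* mono n (toℕ i) i ≡⟨ cong (p i ℤ.*_) (mono-≡ (sym (toℕ-% i))) ⟩
    p i ℤ.* 1ℤ               ≡⟨ ℤₚ.*-identityʳ _ ⟩
    p i ∎

  Lin-mono-shift : ∀ c (h : ℕ → ℕ) p w →
    Lin (λ v → mono n (c + h v)) p ((c + w) mod n) ≡ Lin (λ v → mono n (h v)) p (w mod n)
  Lin-mono-shift c h p w = sum-cong-≗ (λ v → cong (p v ℤ.*_) (mono-shift c (h (toℕ v)) w))

  Lin-∣ : ∀ g {k p} → (∀ i → k ∣ₛ p i) → ∀ i → k ∣ₛ Lin g p i
  Lin-∣ g {k} {p} k∣p i = divides (Lin g q i)
    (trans (Lin-cong g (λ v → trans (_∣ₛ_.equality (k∣p v)) (ℤₚ.*-comm (q v) k)) i)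
      (trans (Lin-· g k q i) (ℤₚ.*-comm k _)))
    where
    q : Poly n
    q v = _∣ₛ_.quotient (k∣p v)

  -- Every monomial has coefficient sum 1, and the order of summation can be exchanged.
  sum-Lin-mono : ∀ (h : ℕ → ℕ) p → sum (Lin (λ v → mono n (h v)) p) ≡ sum p
  sum-Lin-mono h p = begin
    ∑[ i < n ] ∑[ v < n ] (p v ℤ.* mono n (h (toℕ v)) i)
      ≡⟨ ∑-comm (λ i v → p v ℤ.* mono n (h (toℕ v)) i) ⟩
    ∑[ v < n ] ∑[ i < n ] (p v ℤ.* mono n (h (toℕ v)) i)
      ≡⟨ sum-cong-≗ (λ v → trans (sym (*-distribˡ-sum (p v) (mono n (h (toℕ v)))))
           (trans (cong (p v ℤ.*_) (sum-mono (h (toℕ v)))) (ℤₚ.*-identityʳ (p v)))) ⟩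
    sum p ∎

  -- x^v ↦ x^{h v} does not increase the ℓ¹-norm, whereas multiplication by d ≥ 2 does unless p = 0.
  Lin-mono-eigen : ∀ (h : ℕ → ℕ) d → 2 ≤ d → ∀ p →
    (+ d) · p ≗ Lin (λ v → mono n (h v)) p → p ≗ zeroP
  Lin-mono-eigen h d 2≤d p eq i =
    ℤₚ.∣i∣≡0⇒i≡0 (ℕₚ.n≤0⇒n≡0 (ℤₚ.drop‿+≤+ (subst (+ ℤ.∣ p i ∣ ℤ.≤_) ‖p‖≡0 (∣term∣≤sum p i))))
    where
    ‖p‖ : ℤ
    ‖p‖ = ∑[ v < n ] (+ ℤ.∣ p v ∣)
    -- Triangle inequality in each coefficient; monomials have nonnegative coefficients and so keep
    -- their sign.
    bound : ∀ i → + ℤ.∣ + d ℤ.* p i ∣ ℤ.≤ ∑[ v < n ] (+ ℤ.∣ p v ∣ ℤ.* mono n (h (toℕ v)) i)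
    bound i = ℤₚ.≤-trans (ℤₚ.≤-reflexive (cong (λ z → + ℤ.∣ z ∣) (eq i)))
      (ℤₚ.≤-trans (∣sum∣≤sum∣∣ (λ v → p v ℤ.* mono n (h (toℕ v)) i))
        (ℤₚ.≤-reflexive (sum-cong-≗ (λ v → begin
          + ℤ.∣ p v ℤ.* mono n (h (toℕ v)) i ∣ ≡⟨ cong +_ (ℤₚ.∣i*j∣≡∣i∣*∣j∣ (p v) _) ⟩
          + (ℤ.∣ p v ∣ * ℤ.∣ mono n (h (toℕ v)) i ∣) ≡⟨ ℤₚ.pos-* ℤ.∣ p v ∣ _ ⟩
          + ℤ.∣ p v ∣ ℤ.* + ℤ.∣ mono n (h (toℕ v)) i ∣
            ≡⟨ cong (+ ℤ.∣ p v ∣ ℤ.*_) (∣mono∣ (h (toℕ v)) i) ⟩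
          + ℤ.∣ p v ∣ ℤ.* mono n (h (toℕ v)) i ∎))))
    d‖p‖≤‖p‖ : + d ℤ.* ‖p‖ ℤ.≤ ‖p‖
    d‖p‖≤‖p‖ = subst₂ ℤ._≤_
      (trans (sum-cong-≗ (λ i → trans (cong +_ (ℤₚ.∣i*j∣≡∣i∣*∣j∣ (+ d) (p i))) (ℤₚ.pos-* d _)))
             (sym (*-distribˡ-sum (+ d) (λ i → + ℤ.∣ p i ∣))))
      (sum-Lin-mono h (λ v → + ℤ.∣ p v ∣))
      (sum-mono-≤ bound)
    nonneg-fixed : ∀ x → 0ℤ ℤ.≤ x → + d ℤ.* x ℤ.≤ x → x ≡ 0ℤ
    nonneg-fixed (+ zero)  _ _ = refl
    -- The contradiction is `suc k < suc k + suc k ≤ d * suc k`, by `2 ≤ d`.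
    nonneg-fixed (+ suc k) _ dx≤x = contradiction
      (ℤₚ.drop‿+≤+ (subst (ℤ._≤ + suc k) (sym (ℤₚ.pos-* d (suc k))) dx≤x))
      (ℕₚ.<⇒≱ (ℕₚ.<-≤-trans (ℕₚ.m<m+n (suc k) (s≤s z≤n))
        (ℕₚ.≤-trans (ℕₚ.≤-reflexive (sym (cong (λ z → suc k + z) (ℕₚ.+-identityʳ (suc k)))))
          (ℕₚ.*-monoˡ-≤ (suc k) 2≤d))))
    ‖p‖≡0 : ‖p‖ ≡ 0ℤ
    ‖p‖≡0 = nonneg-fixed ‖p‖ (sum-∣∣-nonneg p) d‖p‖≤‖p‖

  -- Multiplication by x - 1.

  shift : ℕ → Poly n
  shift v = mono n (1 + v) ⊖ mono n v

  -- If x p = p, then neighbouring coefficients agree cyclically, and induction on the exponent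
  -- compares each of them with the one at 0.
  Lin-shift-kernel : ∀ p → Lin shift p ≗ zeroP → ∀ i → p i ≡ p (0 mod n)
  Lin-shift-kernel p eq i = subst (λ j → p j ≡ p (0 mod n)) (mod-toℕ i) (const (toℕ i))
    where
    step : ∀ k → p (suc k mod n) ≡ p (k mod n)
    step k = sym (begin
      p (k mod n)                           ≡⟨ sym (Lin-id p (k mod n)) ⟩
      Lin (mono n) p (k mod n)              ≡⟨ sym (Lin-mono-shift 1 (λ v → v) p k) ⟩
      Lin (λ v → mono n (1 + v)) p (suc k mod n)
        ≡⟨ ℤₚ.i-j≡0⇒i≡j _ _ (trans (sym (Linˡ-⊖ (λ v → mono n (1 + v)) (mono n) p (suc k mod n))) (eq (suc k mod n))) ⟩
      Lin (mono n) p (suc k mod n)          ≡⟨ Lin-id p (suc k mod n) ⟩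
      p (suc k mod n)                       ∎)
    const : ∀ k → p (k mod n) ≡ p (0 mod n)
    const zero    = refl
    const (suc k) = trans (step k) (const k)

  -- x^w + … + x^{w+k-1} telescopes under multiplication by x - 1.
  Lin-shift-sumP : ∀ k w → Lin shift (sumP k (λ j → mono n (w + j))) ≗ mono n (w + k) ⊖ mono n w
  Lin-shift-sumP zero w i = begin
    Lin shift zeroP i ≡⟨ Lin-zero shift i ⟩
    0ℤ ≡⟨ sym (ℤₚ.i≡j⇒i-j≡0 (cong (λ k → mono n k i) (ℕₚ.+-identityʳ w))) ⟩
    mono n (w + 0) i - mono n w i ∎
  Lin-shift-sumP (suc k) w i = begin
    Lin shift (sumP k (λ j → mono n (w + j)) ⊕ mono n (w + k)) i ≡⟨ Lin-⊕ shift (sumP k (λ j → mono n (w + j))) (mono n (w + k)) i ⟩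
    Lin shift (sumP k (λ j → mono n (w + j))) i ℤ.+ Lin shift (mono n (w + k)) i
      ≡⟨ cong₂ ℤ._+_ (Lin-shift-sumP k w i) (Lin-mono shift (w + k) i) ⟩
    mono n (w + k) i - mono n w i ℤ.+ (mono n (1 + (w + k) % n) i - mono n ((w + k) % n) i)
      ≡⟨ cong₂ (λ a b → mono n (w + k) i - mono n w i ℤ.+ (a - b))
           (trans (mono-cong-% (%-congˡ-+ 1 {(w + k) % n} {w + k} (m%n%n≡m%n (w + k) n)) i)
                  (cong (λ m → mono n m i) (sym (ℕₚ.+-suc w k))))
           (mono-cong-% (m%n%n≡m%n (w + k) n) i) ⟩
    mono n (w + k) i - mono n w i ℤ.+ (mono n (w + suc k) i - mono n (w + k) i)
      ≡⟨ lemma (mono n (w + k) i) (mono n w i) (mono n (w + suc k) i) ⟩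
    mono n (w + suc k) i - mono n w i ∎
    where
    lemma : ∀ a b c → a - b ℤ.+ (c - a) ≡ c - b
    lemma = solve-∀

-- Spans as images of linear maps.

InSpan-resp : ∀ {n} g {a b} → a ≗ b → InSpan n g b → InSpan n g a
InSpan-resp g eq (c , h) = c , λ i → trans (eq i) (h i)

module _ (n : ℕ) .{{_ : NonZero n}} where

  InSpan⇒Lin : ∀ g {a} → InSpan n g a → ∃ λ b → a ≗ Lin n g b
  InSpan⇒Lin g {a} (c , h) = b , λ i → trans (h i) (go n i {g})
    where
    coeff : ℕ → ℤ
    -- The generator `g 0`, absent from the span, gets weight zero.
    coeff zero    = 0ℤ
    coeff (suc j) = c (suc j)
    b : Poly n
    b v = coeff (toℕ v)
    -- The number `m` of summands is separated from the size `k` of the polynomials, so that `m` can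
    -- be split without touching `Fin k`.
    go : ∀ m {k} (i : Fin k) {g : ℕ → Poly k} →
      sumP (m ∸ 1) (λ j → c (suc j) · g (suc j)) i ≡ ∑[ v < m ] (coeff (toℕ v) ℤ.* g (toℕ v) i)
    go zero i = refl
    go (suc m) i {g} = begin
      sumP m (λ j → c (suc j) · g (suc j)) i ≡⟨ sumP-at m _ i ⟩
      rangeSum m (λ j → c (suc j) ℤ.* g (suc j) i) ≡⟨ sym (sum-toℕ m _) ⟩
      ∑[ v < m ] (c (suc (toℕ v)) ℤ.* g (suc (toℕ v)) i) ≡⟨ sym (ℤₚ.+-identityˡ _) ⟩
      0ℤ ℤ.+ ∑[ v < m ] (c (suc (toℕ v)) ℤ.* g (suc (toℕ v)) i)
        ≡⟨ cong (ℤ._+ ∑[ v < m ] (c (suc (toℕ v)) ℤ.* g (suc (toℕ v)) i)) (sym (ℤₚ.*-zeroˡ (g 0 i))) ⟩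
      0ℤ ℤ.* g 0 i ℤ.+ ∑[ v < m ] (c (suc (toℕ v)) ℤ.* g (suc (toℕ v)) i) ∎

-- A relation k with k₀ = 1 eliminates the generator g₀, which the span omits.
Lin⇒InSpan : ∀ n .{{_ : NonZero n}} g k → k (0 mod n) ≡ 1ℤ → Lin n g k ≗ zeroP →
             ∀ {a} b → a ≗ Lin n g b → InSpan n g a
Lin⇒InSpan (suc m) g k k₀≡1 gk≡0 {a} b eq = (λ j → b′ (j mod suc m)) , λ i → begin
  a i ≡⟨ eq i ⟩
  Lin n g b i ≡⟨ lemma₁ (Lin n g b i) (b Fin.zero) ⟩
  Lin n g b i - b Fin.zero ℤ.* 0ℤ
    ≡⟨ cong (λ z → Lin n g b i - b Fin.zero ℤ.* z) (sym (gk≡0 i)) ⟩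
  Lin n g b i - b Fin.zero ℤ.* Lin n g k i
    ≡⟨ cong (Lin n g b i -_) (sym (Lin-· n g (b Fin.zero) k i)) ⟩
  Lin n g b i - Lin n g (b Fin.zero · k) i ≡⟨ sym (Lin-⊖ n g b (b Fin.zero · k) i) ⟩
  Lin n g b′ i
    ≡⟨ cong₂ ℤ._+_
         (trans (cong (ℤ._* g 0 i) b′₀≡0) (ℤₚ.*-zeroˡ (g 0 i)))
         (sum-cong-≗ (λ v → cong (λ w → b′ w ℤ.* g (suc (toℕ v)) i) (sym (mod-toℕ n (Fin.suc v))))) ⟩
  0ℤ ℤ.+ ∑[ v < m ] (b′ (suc (toℕ v) mod n) ℤ.* g (suc (toℕ v)) i) ≡⟨ ℤₚ.+-identityˡ _ ⟩
  ∑[ v < m ] (b′ (suc (toℕ v) mod n) ℤ.* g (suc (toℕ v)) i) ≡⟨ sum-toℕ m (λ j → b′ (suc j mod n) ℤ.* g (suc j) i) ⟩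
  rangeSum m (λ j → b′ (suc j mod n) ℤ.* g (suc j) i) ≡⟨ sym (sumP-at m _ i) ⟩
  sumP m (λ j → b′ (suc j mod n) · g (suc j)) i ∎
  where
  n : ℕ
  n = suc m
  b′ : Poly n
  -- Subtracting this multiple of the relation keeps the image and makes the coefficient at 0
  -- vanish.
  b′ = b ⊖ (b Fin.zero · k)
  lemma₁ : ∀ x y → x ≡ x - y ℤ.* 0ℤ
  lemma₁ = solve-∀
  b′₀≡0 : b′ Fin.zero ≡ 0ℤ
  b′₀≡0 = trans (cong (λ z → b Fin.zero - b Fin.zero ℤ.* z) k₀≡1) (lemma₂ (b Fin.zero))
    where
    lemma₂ : ∀ x → x - x ℤ.* 1ℤ ≡ 0ℤ
    lemma₂ = solve-∀

-- Here `g` is gcd(n, d), with cofactors `n₁` and `d₁`, and `r` is the number n - n₁ of coordinates.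
-- Given through equations, `r` can be instantiated by a difference, a successor or zero.
module DeBruijn (n d n₁ d₁ g r : ℕ) .{{_ : NonZero n}} .{{_ : NonZero n₁}} .{{_ : NonZero g}}
         (2≤d : 2 ≤ d) (n≡n₁g : n ≡ n₁ * g) (d≡d₁g : d ≡ d₁ * g)
         (coprime : Coprime n₁ d₁) (n₁+r≡n : n₁ + r ≡ n) where

  -- The fibres of multiplication by d on residues modulo n.

  n₁∣n : n₁ ∣ n
  n₁∣n = subst (n₁ ∣_) (sym n≡n₁g) (m∣m*n g)

  n₁≤n : n₁ ≤ n
  n₁≤n = subst (n₁ ≤_) n₁+r≡n (ℕₚ.m≤m+n n₁ r)

  d*n₁≡d₁*n : d * n₁ ≡ d₁ * n
  d*n₁≡d₁*n = begin
    d * n₁        ≡⟨ cong (_* n₁) d≡d₁g ⟩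
    d₁ * g * n₁   ≡⟨ ℕₚ.*-assoc d₁ g n₁ ⟩
    d₁ * (g * n₁) ≡⟨ cong (d₁ *_) (trans (ℕₚ.*-comm g n₁) (sym n≡n₁g)) ⟩
    d₁ * n        ∎

  +d≡+d₁*+g : + d ≡ + d₁ ℤ.* + g
  +d≡+d₁*+g = trans (cong +_ d≡d₁g) (ℤₚ.pos-* d₁ g)

  %n₁-<n : ∀ v → v % n₁ < n
  %n₁-<n v = ℕₚ.<-≤-trans (m%n<n v n₁) n₁≤n

  %n₁-%n : ∀ v → v % n₁ % n ≡ v % n₁
  %n₁-%n v = m<n⇒m%n≡m (%n₁-<n v)

  -- Changing v by q n₁ changes d v by d₁ q n, a multiple of n.
  d*-%n₁ : ∀ v → (d * (v % n₁)) % n ≡ (d * v) % n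
  d*-%n₁ v = sym (trans (%-congˡ (begin
    d * v                             ≡⟨ cong (d *_) (m≡m%n+[m/n]*n v n₁) ⟩
    d * (v % n₁ + q * n₁)             ≡⟨ ℕₚ.*-distribˡ-+ d (v % n₁) (q * n₁) ⟩
    d * (v % n₁) + d * (q * n₁)       ≡⟨ cong (λ z → d * (v % n₁) + z) (begin
      d * (q * n₁)                      ≡⟨ cong (d *_) (ℕₚ.*-comm q n₁) ⟩
      d * (n₁ * q)                      ≡⟨ sym (ℕₚ.*-assoc d n₁ q) ⟩
      d * n₁ * q                        ≡⟨ cong (_* q) d*n₁≡d₁*n ⟩
      d₁ * n * q                        ≡⟨ ℕₚ.*-assoc d₁ n q ⟩
      d₁ * (n * q)                      ≡⟨ cong (d₁ *_) (ℕₚ.*-comm n q) ⟩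
      d₁ * (q * n)                      ≡⟨ sym (ℕₚ.*-assoc d₁ q n) ⟩
      d₁ * q * n                        ∎) ⟩
    d * (v % n₁) + d₁ * q * n         ∎))
    ([m+kn]%n≡m%n (d * (v % n₁)) (d₁ * q) n))
    where
    q : ℕ
    q = v / n₁

  -- For t = b - a, n₁ g divides d₁ t g; cancelling g and then using coprimality gives n₁ ∣ t. The
  -- fibres are thus exactly the classes modulo n₁.
  d*-cancel-≤ : ∀ {a b} → a ≤ b → (d * b) % n ≡ (d * a) % n → b % n₁ ≡ a % n₁
  d*-cancel-≤ {a} {b} a≤b eq = trans (%-congˡ (sym (ℕₚ.m+[n∸m]≡n a≤b))) (%-remove-+ʳ a n₁∣t)
    where
    t : ℕ
    t = b ∸ a
    dt%n≡0 : (d * t) % n ≡ 0 % n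
    dt%n≡0 = %-cancelˡ-+ n (d * a) {d * t} {0} (begin
      (d * a + d * t) % n ≡⟨ %-congˡ (sym (ℕₚ.*-distribˡ-+ d a t)) ⟩
      (d * (a + t)) % n   ≡⟨ %-congˡ (cong (d *_) (ℕₚ.m+[n∸m]≡n a≤b)) ⟩
      (d * b) % n         ≡⟨ eq ⟩
      (d * a) % n         ≡⟨ %-congˡ (sym (ℕₚ.+-identityʳ (d * a))) ⟩
      (d * a + 0) % n     ∎)
    n₁g∣d₁tg : n₁ * g ∣ d₁ * t * g
    n₁g∣d₁tg = subst₂ _∣_ n≡n₁g
      (begin
        d * t        ≡⟨ cong (_* t) d≡d₁g ⟩
        d₁ * g * t   ≡⟨ ℕₚ.*-assoc d₁ g t ⟩
        d₁ * (g * t) ≡⟨ cong (d₁ *_) (ℕₚ.*-comm g t) ⟩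
        d₁ * (t * g) ≡⟨ sym (ℕₚ.*-assoc d₁ t g) ⟩
        d₁ * t * g   ∎)
      (m%n≡0⇒n∣m (d * t) n (trans dt%n≡0 (m<n⇒m%n≡m (ℕₚ.n≢0⇒n>0 (≢-nonZero⁻¹ n)))))
    n₁∣t : n₁ ∣ t
    n₁∣t = coprime-divisor coprime (*-cancelʳ-∣ g n₁g∣d₁tg)

  d*-cancel : ∀ {a b} → (d * a) % n ≡ (d * b) % n → a % n₁ ≡ b % n₁
  d*-cancel {a} {b} eq with ℕₚ.≤-total a b
  ... | inj₁ a≤b = sym (d*-cancel-≤ a≤b (sym eq))
  ... | inj₂ b≤a = d*-cancel-≤ b≤a eq

  -- The operators T, U, R and S = x - 1, and the relations between them.

  Tg Ug Rg : ℕ → Poly n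
  Tg v = mono n (d * v)
  Ug v = sumP d (λ j → mono n (d * v + j))
  Rg v = mono n (v % n₁)

  T U R S : Poly n → Poly n
  T = Lin n Tg
  U = Lin n Ug
  R = Lin n Rg
  S = Lin n (shift n)

  d*-%n : ∀ v → (d * (v % n)) % n ≡ (d * v) % n
  d*-%n v = %-congˡ-* n d {v % n} {v} (m%n%n≡m%n v n)

  T-mono : ∀ v → T (mono n v) ≗ mono n (d * v)
  T-mono v i = trans (Lin-mono n Tg v i) (mono-cong-% n (d*-%n v) i)

  Ug-cong : ∀ {v w} → (d * v) % n ≡ (d * w) % n → Ug v ≗ Ug w
  Ug-cong {v} {w} eq = sumP-cong d (λ j → mono-cong-% n
    (trans (%-congˡ (ℕₚ.+-comm (d * v) j))
      (trans (%-congˡ-+ n j {d * v} {d * w} eq) (%-congˡ (ℕₚ.+-comm j (d * w))))))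

  U-mono : ∀ v → U (mono n v) ≗ Ug v
  U-mono v i = trans (Lin-mono n Ug v i) (Ug-cong (d*-%n v) i)

  R-mono : ∀ v → R (mono n v) ≗ mono n (v % n₁)
  R-mono v i = trans (Lin-mono n Rg v i) (cong (λ m → mono n m i) (m∣n⇒o%n%m≡o%m n₁ n v n₁∣n))

  -- On monomials, T and U depend on v only through d v modulo n, which `d*-%n₁` shows to be
  -- unchanged when v is reduced modulo n₁.
  TR≗T : ∀ p → T (R p) ≗ T p
  TR≗T p i = trans (Lin-∘ n Tg Rg p i)
    (Lin-congˡ n p (λ v j → trans (T-mono (v % n₁) j) (mono-cong-% n (d*-%n₁ v) j)) i)

  UR≗U : ∀ p → U (R p) ≗ U p
  UR≗U p i = trans (Lin-∘ n Ug Rg p i)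
    (Lin-congˡ n p (λ v j → trans (U-mono (v % n₁) j) (Ug-cong (d*-%n₁ v) j)) i)

  RR≗R : ∀ p → R (R p) ≗ R p
  RR≗R p i = trans (Lin-∘ n Rg Rg p i)
    (Lin-congˡ n p (λ v j → trans (R-mono (v % n₁) j) (cong (λ m → mono n m j) (m%n%n≡m%n v n₁))) i)

  T-shift : ∀ v → T (shift n v) ≗ mono n (d + d * v) ⊖ mono n (d * v)
  T-shift v i = trans (Lin-⊖ n Tg (mono n (1 + v)) (mono n v) i)
    (cong₂ _-_ (trans (T-mono (1 + v) i) (cong (λ m → mono n m i) (ℕₚ.*-suc d v))) (T-mono v i))

  -- On x^v both sides are x^{dv+d} - x^{dv}: directly on the left, by telescoping on the right.
  TS≗SU : ∀ p → T (S p) ≗ S (U p)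
  TS≗SU p i = begin
    T (S p) i ≡⟨ Lin-∘ n Tg (shift n) p i ⟩
    Lin n (λ v → T (shift n v)) p i ≡⟨ Lin-congˡ n p (λ v j → trans (T-shift v j) (trans
      (cong (λ m → mono n m j - mono n (d * v) j) (ℕₚ.+-comm d (d * v)))
      (sym (Lin-shift-sumP n d (d * v) j)))) i ⟩
    Lin n (λ v → S (Ug v)) p i ≡⟨ sym (Lin-∘ n (shift n) Ug p i) ⟩
    S (U p) i ∎

  -- T(x p) = x^d T p, so the coefficients of T(x - 1)p are differences of coefficients of T p at
  -- distance d. This is what lets an induction walk along the multiples of d.
  T-S : ∀ p w → T (S p) ((d + w) mod n) ≡ T p (w mod n) - T p ((d + w) mod n)
  T-S p w = begin
    T (S p) ((d + w) mod n) ≡⟨ Lin-∘ n Tg (shift n) p ((d + w) mod n) ⟩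
    Lin n (λ v → T (shift n v)) p ((d + w) mod n) ≡⟨ Lin-congˡ n p T-shift ((d + w) mod n) ⟩
    Lin n (λ v → mono n (d + d * v) ⊖ mono n (d * v)) p ((d + w) mod n)
      ≡⟨ Linˡ-⊖ n (λ v → mono n (d + d * v)) Tg p ((d + w) mod n) ⟩
    Lin n (λ v → mono n (d + d * v)) p ((d + w) mod n) - T p ((d + w) mod n)
      ≡⟨ cong (_- T p ((d + w) mod n)) (Lin-mono-shift n d (d *_) p w) ⟩
    T p (w mod n) - T p ((d + w) mod n) ∎

  -- Values at the all-ones vector and at P; coefficients of R.

  ∑mono : ∀ i → rangeSum n (λ v → mono n v i) ≡ 1ℤ
  ∑mono i = begin
    rangeSum n (λ v → mono n v i) ≡⟨ sym (sum-toℕ n (λ v → mono n v i)) ⟩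
    ∑[ v < n ] mono n (toℕ v) i ≡⟨ sum-cong-≗ {n} (λ v → sym (ℤₚ.*-identityˡ (mono n (toℕ v) i))) ⟩
    Lin n (mono n) (𝟏 n) i ≡⟨ Lin-id n (𝟏 n) i ⟩
    1ℤ ∎

  Lin-𝟏 : ∀ g i → Lin n g (𝟏 n) i ≡ rangeSum n (λ v → g v i)
  Lin-𝟏 g i = trans (sum-cong-≗ {n} (λ v → ℤₚ.*-identityˡ (g (toℕ v) i))) (sum-toℕ n (λ v → g v i))

  -- The exponents d v + j with v < n and j < d run once through 0, ..., nd - 1, which is d full
  -- periods modulo n.
  U-𝟏 : ∀ i → U (𝟏 n) i ≡ + d
  U-𝟏 i = begin
    U (𝟏 n) i                                       ≡⟨ Lin-𝟏 Ug i ⟩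
    rangeSum n (λ v → Ug v i)                       ≡⟨ rangeSum-cong n (λ v → sumP-at d (λ j → mono n (d * v + j)) i) ⟩
    rangeSum n (λ v → rangeSum d (λ j → m (d * v + j))) ≡⟨ sym (rangeSum-* n d m) ⟩
    rangeSum (n * d) m                              ≡⟨ cong (λ k → rangeSum k m) (ℕₚ.*-comm n d) ⟩
    rangeSum (d * n) m                              ≡⟨ rangeSum-* d n m ⟩
    rangeSum d (λ q → rangeSum n (λ j → m (n * q + j)))
      ≡⟨ rangeSum-cong d (λ q → trans (rangeSum-cong n (λ j → mono-cong-% n (periodic q j) i)) (∑mono i)) ⟩
    rangeSum d (λ _ → 1ℤ)                           ≡⟨ rangeSum-const d 1ℤ ⟩
    + d ℤ.* 1ℤ                                      ≡⟨ ℤₚ.*-identityʳ (+ d) ⟩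
    + d                                             ∎
    where
    m : ℕ → ℤ
    m v = mono n v i
    periodic : ∀ q j → (n * q + j) % n ≡ j % n
    periodic q j = %-remove-+ˡ j (m∣m*n q)

  P : Poly n
  P i = rangeSum n₁ (λ v → mono n v i)

  -- The range 0, ..., n - 1 consists of g periods modulo n₁.
  R-𝟏 : ∀ i → R (𝟏 n) i ≡ + g ℤ.* P i
  R-𝟏 i = begin
    R (𝟏 n) i                          ≡⟨ Lin-𝟏 Rg i ⟩
    rangeSum n m                       ≡⟨ cong (λ k → rangeSum k m) (trans n≡n₁g (ℕₚ.*-comm n₁ g)) ⟩
    rangeSum (g * n₁) m                ≡⟨ rangeSum-* g n₁ m ⟩
    rangeSum g (λ q → rangeSum n₁ (λ j → m (n₁ * q + j)))
      ≡⟨ rangeSum-cong g (λ q → trans (sym (sum-toℕ n₁ (λ j → m (n₁ * q + j)))) (trans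
           (sum-cong-≗ {n₁} (λ j → cong (λ k → mono n k i) (trans (%-remove-+ˡ (toℕ j) (m∣m*n q)) (toℕ-% n₁ j))))
           (sum-toℕ n₁ (λ v → mono n v i)))) ⟩
    rangeSum g (λ _ → P i)             ≡⟨ rangeSum-const g (P i) ⟩
    + g ℤ.* P i                        ∎
    where
    m : ℕ → ℤ
    m v = mono n (v % n₁) i

  P-< : ∀ i → toℕ i < n₁ → P i ≡ 1ℤ
  P-< i i<n₁ = begin
    P i                          ≡⟨ sym (sum-toℕ n₁ (λ v → mono n v i)) ⟩
    ∑[ v < n₁ ] mono n (toℕ v) i ≡⟨ sum-single k (λ v → mono n (toℕ v) i) (λ j j≢k → mono-≢ n (λ eq → j≢k
      (toℕ-injective (trans (sym (trans eq (m<n⇒m%n≡m (ℕₚ.<-≤-trans (toℕ<n j) n₁≤n)))) (sym k≡i))))) ⟩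
    mono n (toℕ k) i             ≡⟨ mono-≡ n (sym (trans (%-congˡ k≡i) (toℕ-% n i))) ⟩
    1ℤ                           ∎
    where
    k : Fin n₁
    k = Fin.fromℕ< i<n₁
    k≡i : toℕ k ≡ toℕ i
    k≡i = toℕ-fromℕ< i<n₁

  R-≥ : ∀ p i → n₁ ≤ toℕ i → R p i ≡ 0ℤ
  R-≥ p i n₁≤i = trans
    (sum-cong-≗ {n} {_} {λ _ → 0ℤ} (λ v → trans
      (cong (p v ℤ.*_) (mono-≢ n {toℕ v % n₁} (λ eq →
        ℕₚ.<⇒≱ (m%n<n (toℕ v) n₁) (subst (n₁ ≤_) (trans eq (%n₁-%n (toℕ v))) n₁≤i))))
      (ℤₚ.*-zeroʳ (p v))))
    (sum-replicate-zero n)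

  -- Both coefficients are the sum of p over the class of i modulo n₁, since that class is a fibre
  -- of multiplication by d. Divisibility of T p thereby passes to R p.
  R-< : ∀ p i → toℕ i < n₁ → R p i ≡ T p ((d * toℕ i) mod n)
  R-< p i i<n₁ = sum-cong-≗ {n} (λ v → cong (p v ℤ.*_) (mono-≡-mono n {toℕ v % n₁} {d * toℕ v}
    (λ eq → trans (toℕ-mod n _) (trans (%-congˡ (cong (d *_) (trans eq (%n₁-%n _)))) (d*-%n₁ (toℕ v))))
    (λ eq → trans (sym (m<n⇒m%n≡m i<n₁)) (trans (d*-cancel {toℕ i} {toℕ v} (trans (sym (toℕ-mod n _)) eq)) (sym (%n₁-%n _))))))

  R-supported : ∀ p → (∀ i → n₁ ≤ toℕ i → p i ≡ 0ℤ) → R p ≗ p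
  R-supported p p≡0 i = trans (sum-cong-≗ {n} term) (Lin-id n p i)
    where
    term : ∀ v → p v ℤ.* mono n (toℕ v % n₁) i ≡ p v ℤ.* mono n (toℕ v) i
    term v with toℕ v ℕₚ.<? n₁
    ... | yes v<n₁ = cong (λ k → p v ℤ.* mono n k i) (m<n⇒m%n≡m v<n₁)
    ... | no v≮n₁ rewrite p≡0 v (ℕₚ.≮⇒≥ v≮n₁) = refl

  0-mod : toℕ (0 mod n) ≡ 0
  0-mod = trans (toℕ-mod n 0) (m<n⇒m%n≡m (ℕₚ.n≢0⇒n>0 (≢-nonZero⁻¹ n)))

  P-0 : P (0 mod n) ≡ 1ℤ
  P-0 = P-< (0 mod n) (subst (_< n₁) (sym 0-mod) (ℕₚ.n≢0⇒n>0 (≢-nonZero⁻¹ n₁)))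

  -- Obtained by cancelling g in g U P = U R `𝟏` = U `𝟏` = d.
  U-P : ∀ i → U P i ≡ + d₁
  U-P i = ℤₚ.*-cancelˡ-≡ (+ g) (U P i) (+ d₁) (begin
    + g ℤ.* U P i     ≡⟨ sym (Lin-· n Ug (+ g) P i) ⟩
    U ((+ g) · P) i   ≡⟨ Lin-cong n Ug (λ j → sym (R-𝟏 j)) i ⟩
    U (R (𝟏 n)) i     ≡⟨ UR≗U (𝟏 n) i ⟩
    U (𝟏 n) i         ≡⟨ U-𝟏 i ⟩
    + d               ≡⟨ +d≡+d₁*+g ⟩
    + d₁ ℤ.* + g      ≡⟨ ℤₚ.*-comm (+ d₁) (+ g) ⟩
    + g ℤ.* + d₁      ∎)

  -- The kernels of d - T and d - U.

  T-eigen : ∀ p → (+ d) · p ≗ T p → p ≗ zeroP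
  T-eigen = Lin-mono-eigen n (d *_) d 2≤d

  -- (x - 1)U = T(x - 1) turns a fixed vector of U/d into one of T/d, which must vanish.
  U-eigen : ∀ p → (+ d) · p ≗ U p → ∀ i → p i ≡ p (0 mod n)
  U-eigen p eq = Lin-shift-kernel n p (T-eigen (S p) (λ i → begin
    + d ℤ.* S p i     ≡⟨ sym (Lin-· n (shift n) (+ d) p i) ⟩
    S ((+ d) · p) i   ≡⟨ Lin-cong n (shift n) eq i ⟩
    S (U p) i         ≡⟨ sym (TS≗SU p i) ⟩
    T (S p) i         ∎))

  -- The coordinates are placed at the exponents n₁, ..., n - 1, exactly those which reduction
  -- modulo n₁ moves; below n₁ the default is zero.
  ext : (Fin r → ℤ) → Poly n
  ext y v with n₁ ℕₚ.≤? toℕ v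
  ... | yes n₁≤v = y (Fin.fromℕ< (ℕₚ.+-cancelˡ-< n₁ (toℕ v ∸ n₁) r
                     (subst₂ _<_ (sym (ℕₚ.m+[n∸m]≡n n₁≤v)) (sym n₁+r≡n) (toℕ<n v))))
  ... | no _     = 0ℤ

  idx : Fin r → Fin n
  idx j = Fin.fromℕ< (subst (n₁ + toℕ j <_) n₁+r≡n (ℕₚ.+-monoʳ-< n₁ (toℕ<n j)))

  toℕ-idx : ∀ j → toℕ (idx j) ≡ n₁ + toℕ j
  toℕ-idx j = toℕ-fromℕ< _

  n₁≤idx : ∀ j → n₁ ≤ toℕ (idx j)
  n₁≤idx j = subst (n₁ ≤_) (sym (toℕ-idx j)) (ℕₚ.m≤m+n n₁ (toℕ j))

  ext-idx : ∀ y j → ext y (idx j) ≡ y j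
  ext-idx y j with n₁ ℕₚ.≤? toℕ (idx j)
  ... | yes _ = cong y (toℕ-injective (trans (toℕ-fromℕ< _)
                  (trans (cong (_∸ n₁) (toℕ-idx j)) (ℕₚ.m+n∸m≡n n₁ (toℕ j)))))
  ... | no n₁≰ = contradiction (n₁≤idx j) n₁≰

  ext-restrict : ∀ p v → n₁ ≤ toℕ v → ext (p ∘ idx) v ≡ p v
  ext-restrict p v n₁≤v with n₁ ℕₚ.≤? toℕ v
  ... | yes _ = cong p (toℕ-injective (trans (toℕ-idx _) (trans (cong (λ z → n₁ + z) (toℕ-fromℕ< _)) (ℕₚ.m+[n∸m]≡n n₁≤v))))
  ... | no n₁≰v = contradiction n₁≤v n₁≰v

  ext-zipWith : ∀ (_∙_ : ℤ → ℤ → ℤ) → 0ℤ ∙ 0ℤ ≡ 0ℤ → ∀ y z v →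
                ext (λ j → y j ∙ z j) v ≡ ext y v ∙ ext z v
  ext-zipWith _∙_ 0∙0 y z v with n₁ ℕₚ.≤? toℕ v
  ... | yes _ = refl
  ... | no _  = sym 0∙0

  ext-cong : ∀ {y z} → y ≗ z → ext y ≗ ext z
  ext-cong eq v with n₁ ℕₚ.≤? toℕ v
  ... | yes _ = eq _
  ... | no _  = refl

  -- φ y = Σ_j y_j (x^{n₁+j} - x^{(n₁+j) mod n₁}); these differences are a basis of ker T over ℤ.
  φ : (Fin r → ℤ) → Poly n
  φ y = ext y ⊖ R (ext y)

  -- R fixes the part of p supported below n₁, so this part cancels in p - R p.
  φ-restrict : ∀ p → p ⊖ R p ≗ φ (p ∘ idx)
  φ-restrict p i = lemma (p i) (q i) (R p i) (R q i)
    (trans (sym (Lin-⊖ n Rg p q i)) (R-supported (p ⊖ q)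
      (λ v n₁≤v → ℤₚ.i≡j⇒i-j≡0 (sym (ext-restrict p v n₁≤v))) i))
    where
    q : Poly n
    q = ext (p ∘ idx)
    lemma : ∀ a b x y → x - y ≡ a - b → a - x ≡ b - y
    lemma a b x y eq = begin
      a - x                   ≡⟨ l₁ a b x y ⟩
      a - b - (x - y) ℤ.+ (b - y) ≡⟨ cong (λ z → a - b - z ℤ.+ (b - y)) eq ⟩
      a - b - (a - b) ℤ.+ (b - y) ≡⟨ l₂ (a - b) (b - y) ⟩
      b - y ∎
      where
      l₁ : ∀ a b x y → a - x ≡ a - b - (x - y) ℤ.+ (b - y)
      l₁ = solve-∀
      l₂ : ∀ a b → a - a ℤ.+ b ≡ b
      l₂ = solve-∀

  φ-cong : ∀ {y z} → y ≗ z → φ y ≗ φ z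
  φ-cong eq i = cong₂ _-_ (ext-cong eq i) (Lin-cong n Rg (ext-cong eq) i)

  φ-⊖ : ∀ y z → φ (λ j → y j - z j) ≗ φ y ⊖ φ z
  φ-⊖ y z i = trans
    (cong₂ _-_ (ext-- i) (trans (Lin-cong n Rg ext-- i) (Lin-⊖ n Rg (ext y) (ext z) i)))
    (lemma (ext y i) (ext z i) (R (ext y) i) (R (ext z) i))
    where
    ext-- : ext (λ j → y j - z j) ≗ ext y ⊖ ext z
    ext-- = ext-zipWith _-_ refl y z
    lemma : ∀ a b x y → a - b - (x - y) ≡ a - x - (b - y)
    lemma = solve-∀

  φ-· : ∀ k y → φ (λ j → k ℤ.* y j) ≗ k · φ y
  φ-· k y i = trans
    (cong₂ _-_ (ext-* i) (trans (Lin-cong n Rg ext-* i) (Lin-· n Rg k (ext y) i)))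
    (lemma k (ext y i) (R (ext y) i))
    where
    ext-* : ext (λ j → k ℤ.* y j) ≗ k · ext y
    ext-* = ext-zipWith (λ a _ → k ℤ.* a) (ℤₚ.*-zeroʳ k) y y
    lemma : ∀ k a x → k ℤ.* a - k ℤ.* x ≡ k ℤ.* (a - x)
    lemma = solve-∀

  φ-⊕ : ∀ y z → φ (addV y z) ≗ φ y ⊕ φ z
  φ-⊕ y z i = begin
    φ (addV y z) i                    ≡⟨ lemma (φ (addV y z) i) (φ z i) ⟩
    φ (addV y z) i - φ z i ℤ.+ φ z i  ≡⟨ cong (ℤ._+ φ z i) (sym (φ-⊖ (addV y z) z i)) ⟩
    φ (λ j → y j ℤ.+ z j - z j) i ℤ.+ φ z i ≡⟨ cong (ℤ._+ φ z i) (φ-cong (λ j → sym (lemma′ (y j) (z j))) i) ⟩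
    φ y i ℤ.+ φ z i                   ∎
    where
    lemma : ∀ a b → a ≡ a - b ℤ.+ b
    lemma = solve-∀
    lemma′ : ∀ a b → a ≡ a ℤ.+ b - b
    lemma′ = solve-∀

  -- R (`ext y`) has no terms at exponents from n₁ on, so the coordinates can be read off there.
  φ-idx : ∀ y j → φ y (idx j) ≡ y j
  φ-idx y j = trans (cong₂ _-_ (ext-idx y j) (R-≥ (ext y) (idx j) (n₁≤idx j))) (ℤₚ.+-identityʳ (y j))

  -- A linear map that agrees on p and R p kills every b - R b; this covers T, U and R at once.
  φ-kernel : ∀ h → (∀ p → Lin n h (R p) ≗ Lin n h p) → ∀ y → Lin n h (φ y) ≗ zeroP
  φ-kernel h hR y i = trans (Lin-⊖ n h (ext y) (R (ext y)) i) (ℤₚ.i≡j⇒i-j≡0 (sym (hR (ext y) i)))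

  sum-φ : ∀ y → sum (φ y) ≡ 0ℤ
  sum-φ y = trans (sum-- (ext y) (R (ext y))) (ℤₚ.i≡j⇒i-j≡0 (sym (sum-Lin-mono n (_% n₁) (ext y))))

  φ-𝟏 : φ (λ _ → 1ℤ) ≗ 𝟏 n ⊖ ((+ g) · P)
  φ-𝟏 i = trans (sym (φ-restrict (𝟏 n) i)) (cong (1ℤ -_) (R-𝟏 i))

  -- Δ Tg = d - T maps 𝒵_n onto the span of the ε_v; Δ Ug = d - U maps ℤ^n onto the span of the f_v.
  Δ : (ℕ → Poly n) → Poly n → Poly n
  Δ h p = ((+ d) · p) ⊖ Lin n h p

  Δ-⊖ : ∀ h p q → Δ h (p ⊖ q) ≗ Δ h p ⊖ Δ h q
  Δ-⊖ h p q i = trans (cong (λ z → + d ℤ.* (p i - q i) - z) (Lin-⊖ n h p q i))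
    (lemma (+ d) (p i) (q i) (Lin n h p i) (Lin n h q i))
    where
    lemma : ∀ d a b x y → d ℤ.* (a - b) - (x - y) ≡ d ℤ.* a - x - (d ℤ.* b - y)
    lemma = solve-∀

  Δ-⊕ : ∀ h p q → Δ h (p ⊕ q) ≗ Δ h p ⊕ Δ h q
  Δ-⊕ h p q i = trans (cong (λ z → + d ℤ.* (p i ℤ.+ q i) - z) (Lin-⊕ n h p q i))
    (lemma (+ d) (p i) (q i) (Lin n h p i) (Lin n h q i))
    where
    lemma : ∀ d a b x y → d ℤ.* (a ℤ.+ b) - (x ℤ.+ y) ≡ d ℤ.* a - x ℤ.+ (d ℤ.* b - y)
    lemma = solve-∀

  Δ-· : ∀ h k p → Δ h (k · p) ≗ k · Δ h p
  Δ-· h k p i = trans (cong (λ z → + d ℤ.* (k ℤ.* p i) - z) (Lin-· n h k p i))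
    (lemma (+ d) k (p i) (Lin n h p i))
    where
    lemma : ∀ d k a x → d ℤ.* (k ℤ.* a) - k ℤ.* x ≡ k ℤ.* (d ℤ.* a - x)
    lemma = solve-∀

  Δ-cong : ∀ h {p q} → p ≗ q → Δ h p ≗ Δ h q
  Δ-cong h eq i = cong₂ (λ a b → + d ℤ.* a - b) (eq i) (Lin-cong n h eq i)

  Δ-φ : ∀ h → (∀ p → Lin n h (R p) ≗ Lin n h p) → ∀ y → Δ h (φ y) ≗ (+ d) · φ y
  Δ-φ h hR y i = trans (cong (λ z → + d ℤ.* φ y i - z) (φ-kernel h hR y i)) (ℤₚ.+-identityʳ _)

  -- Both `Δ h (φ y)` and `Δ h` of d c equal d φ y. Membership of φ y in a lattice thus becomes a
  -- question about the kernel of `Δ h`.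
  Δ-φ-· : ∀ h → (∀ p → Lin n h (R p) ≗ Lin n h p) → ∀ y c → φ y ≗ Δ h c →
          Δ h (φ y ⊖ ((+ d) · c)) ≗ zeroP
  Δ-φ-· h hR y c φy≗Δc i = begin
    Δ h (φ y ⊖ ((+ d) · c)) i            ≡⟨ Δ-⊖ h (φ y) ((+ d) · c) i ⟩
    Δ h (φ y) i - Δ h ((+ d) · c) i      ≡⟨ cong₂ _-_ (Δ-φ h hR y i) (Δ-· h (+ d) c i) ⟩
    + d ℤ.* φ y i - + d ℤ.* Δ h c i      ≡⟨ ℤₚ.i≡j⇒i-j≡0 {+ d ℤ.* φ y i} (cong (+ d ℤ.*_) (φy≗Δc i)) ⟩
    0ℤ ∎

  Δ-zero : ∀ h → Δ h zeroP ≗ zeroP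
  Δ-zero h i = cong₂ _-_ (ℤₚ.*-zeroʳ (+ d)) (Lin-zero n h i)

  Δ-ker : ∀ h p → Δ h p ≗ zeroP → (+ d) · p ≗ Lin n h p
  Δ-ker h p eq i = ℤₚ.i-j≡0⇒i≡j (+ d ℤ.* p i) (Lin n h p i) (eq i)

  -- The three lattices in terms of coefficient sums and Δ.

  Lin-e : ∀ p → Lin n (e n) p ≗ p ⊖ (sum p · mono n 0)
  Lin-e p i = trans (Linˡ-⊖ n (mono n) (λ _ → mono n 0) p i)
    (cong₂ _-_ (Lin-id n p i) (Lin-const n (mono n 0) p i))

  e-0 : ∀ i → e n 0 i ≡ 0ℤ
  e-0 i = ℤₚ.+-inverseʳ (mono n 0 i)

  mono-0-0 : mono n 0 (0 mod n) ≡ 1ℤ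
  mono-0-0 = mono-≡ n (toℕ-mod n 0)

  0%n : 0 % n ≡ 0
  0%n = trans (sym (toℕ-mod n 0)) 0-mod

  -- With coefficient sum zero, p is the combination of the e_v whose weights are its own
  -- coefficients; the index 0 drops out because e_0 = 0.
  sum-zero⇒InZ : ∀ p → sum p ≡ 0ℤ → InZ n p
  sum-zero⇒InZ p s≡0 = Lin⇒InSpan n (e n) (mono n 0) mono-0-0
    (λ i → trans (Lin-mono n (e n) 0 i) (trans (cong (λ k → e n k i) 0%n) (e-0 i)))
    p (λ i → sym (trans (Lin-e p i) (trans
      (cong (λ s → p i - s ℤ.* mono n 0 i) s≡0) (ℤₚ.+-identityʳ (p i)))))

  sum-normalised : ∀ p → sum (p ⊖ (sum p · mono n 0)) ≡ 0ℤ
  sum-normalised p = begin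
    sum (p ⊖ (sum p · mono n 0))   ≡⟨ sum-- p (sum p · mono n 0) ⟩
    sum p - sum (sum p · mono n 0) ≡⟨ cong (λ z → sum p - z) (trans (sym (*-distribˡ-sum (sum p) (mono n 0)))
                                       (trans (cong (sum p ℤ.*_) (sum-mono n 0)) (ℤₚ.*-identityʳ (sum p)))) ⟩
    sum p - sum p                  ≡⟨ ℤₚ.+-inverseʳ (sum p) ⟩
    0ℤ                             ∎

  φ∈Z : ∀ y → InZ n (φ y)
  φ∈Z y = sum-zero⇒InZ (φ y) (sum-φ y)

  -- T fixes x^0, so ε_v = (d - T) e_v. Subtracting the coefficient sum at x^0 is the projection
  -- onto 𝒵_n.
  Lin-ε : ∀ p → Lin n (ε n d) p ≗ Δ Tg (p ⊖ (sum p · mono n 0))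
  Lin-ε p i = begin
    Lin n (ε n d) p i
      ≡⟨ Linˡ-⊖ n (λ v → (+ d) · e n v) (λ v → e n (d * v)) p i ⟩
    Lin n (λ v → (+ d) · e n v) p i - Lin n (λ v → e n (d * v)) p i
      ≡⟨ cong₂ _-_
           (trans (Linˡ-· n (+ d) (e n) p i) (cong (+ d ℤ.*_) (Lin-e p i)))
           (trans (Linˡ-⊖ n Tg (λ _ → mono n 0) p i) (cong (λ z → T p i - z) (Lin-const n (mono n 0) p i))) ⟩
    + d ℤ.* (p i - sum p ℤ.* mono n 0 i) - (T p i - sum p ℤ.* mono n 0 i)
      ≡⟨ cong (λ z → + d ℤ.* (p i - sum p ℤ.* mono n 0 i) - (T p i - sum p ℤ.* z))
           (sym (trans (T-mono 0 i) (cong (λ k → mono n k i) (ℕₚ.*-zeroʳ d)))) ⟩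
    + d ℤ.* (p i - sum p ℤ.* mono n 0 i) - (T p i - sum p ℤ.* T (mono n 0) i)
      ≡⟨ cong (λ z → + d ℤ.* (p i - sum p ℤ.* mono n 0 i) - z)
           (sym (trans (Lin-⊖ n Tg p (sum p · mono n 0) i) (cong (λ z → T p i - z) (Lin-· n Tg (sum p) (mono n 0) i)))) ⟩
    Δ Tg (p ⊖ (sum p · mono n 0)) i ∎

  InSpan-ε⇒Δ : ∀ {a} → InSpan n (ε n d) a → ∃ λ b → sum b ≡ 0ℤ × a ≗ Δ Tg b
  InSpan-ε⇒Δ a∈E with InSpan⇒Lin n (ε n d) a∈E
  ... | b , a≗ = b ⊖ (sum b · mono n 0) , sum-normalised b , λ i → trans (a≗ i) (Lin-ε b i)

  -- The relation that eliminates the index 0 is ε_0 = 0.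
  Δ⇒InSpan-ε : ∀ {a} b → sum b ≡ 0ℤ → a ≗ Δ Tg b → InSpan n (ε n d) a
  Δ⇒InSpan-ε {a} b s≡0 a≗ = Lin⇒InSpan n (ε n d) (mono n 0) mono-0-0
    (λ i → begin
      Lin n (ε n d) (mono n 0) i ≡⟨ Lin-mono n (ε n d) 0 i ⟩
      ε n d (0 % n) i            ≡⟨ cong (λ k → ε n d k i) 0%n ⟩
      + d ℤ.* e n 0 i - e n (d * 0) i
        ≡⟨ cong₂ (λ x y → + d ℤ.* x - y) (e-0 i) (trans (cong (λ k → e n k i) (ℕₚ.*-zeroʳ d)) (e-0 i)) ⟩
      + d ℤ.* 0ℤ - 0ℤ            ≡⟨ trans (ℤₚ.+-identityʳ _) (ℤₚ.*-zeroʳ (+ d)) ⟩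
      0ℤ                         ∎)
    b (λ i → trans (a≗ i) (trans
      (Δ-cong Tg (λ j → sym (trans (cong (λ s → b j - s ℤ.* mono n 0 j) s≡0) (ℤₚ.+-identityʳ (b j)))) i)
      (sym (Lin-ε b i))))

  Lin-f : ∀ p → Lin n (f n d) p ≗ Δ Ug p
  Lin-f p i = trans (Linˡ-⊖ n (λ v → (+ d) · mono n v) Ug p i)
    (cong (_- U p i) (trans (Linˡ-· n (+ d) (mono n) p i) (cong (+ d ℤ.*_) (Lin-id n p i))))

  InSpan-f⇒Δ : ∀ {a} → InSpan n (f n d) a → ∃ λ b → a ≗ Δ Ug b
  InSpan-f⇒Δ a∈F with InSpan⇒Lin n (f n d) a∈F
  ... | b , a≗ = b , λ i → trans (a≗ i) (Lin-f b i)

  -- The sum of all f_v is d `𝟏` - U `𝟏` = 0, which expresses f_0 through the other generators.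
  Δ⇒InSpan-f : ∀ {a} b → a ≗ Δ Ug b → InSpan n (f n d) a
  Δ⇒InSpan-f b a≗ = Lin⇒InSpan n (f n d) (𝟏 n) refl
    (λ i → trans (Lin-f (𝟏 n) i) (trans (cong (λ z → + d ℤ.* 1ℤ - z) (U-𝟏 i)) (ℤₚ.i≡j⇒i-j≡0 (ℤₚ.*-identityʳ (+ d)))))
    b (λ i → trans (a≗ i) (sym (Lin-f b i)))

  -- Which values of φ lie in the lattices, and why they exhaust the kernels.

  φ-cong-mod : ∀ x y → CongMod (constMod r d) x y → ∃ λ z → φ x ⊖ φ y ≗ (+ d) · φ z
  φ-cong-mod x y x≡y = z , λ i → trans (sym (φ-⊖ x y i)) (trans (φ-cong x-y≗dz i) (φ-· (+ d) z i))
    where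
    q : ∀ j → + d ∣ₛ x j - y j
    q j = ∣ₛ.∣ᵤ⇒∣ (x≡y j)
    z : Fin r → ℤ
    z j = _∣ₛ_.quotient (q j)
    x-y≗dz : ∀ j → x j - y j ≡ + d ℤ.* z j
    x-y≗dz j = trans (_∣ₛ_.equality (q j)) (ℤₚ.*-comm (z j) (+ d))

  d·φ∈E : ∀ y → InSpan n (ε n d) ((+ d) · φ y)
  d·φ∈E y = Δ⇒InSpan-ε (φ y) (sum-φ y) (λ i → sym (Δ-φ Tg TR≗T y i))

  d·φ∈F : ∀ y → InSpan n (f n d) ((+ d) · φ y)
  d·φ∈F y = Δ⇒InSpan-f (φ y) (λ i → sym (Δ-φ Ug UR≗U y i))

  -- If φ y = (d - T) c, then φ y - d c is in the kernel of d - T and vanishes; the coefficients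
  -- from n₁ on then give y.
  φ-inj-ε : ∀ y → InSpan n (ε n d) (φ y) → ∀ j → + d ∣ₛ y j
  φ-inj-ε y φy∈E j = divides (c (idx j)) (begin
    y j                 ≡⟨ sym (φ-idx y j) ⟩
    φ y (idx j)         ≡⟨ ℤₚ.i-j≡0⇒i≡j (φ y (idx j)) (+ d ℤ.* c (idx j)) (T-eigen q (Δ-ker Tg q Δq≗0) (idx j)) ⟩
    + d ℤ.* c (idx j)   ≡⟨ ℤₚ.*-comm (+ d) (c (idx j)) ⟩
    c (idx j) ℤ.* + d   ∎)
    where
    c : Poly n
    c = proj₁ (InSpan-ε⇒Δ φy∈E)
    q : Poly n
    q = φ y ⊖ ((+ d) · c)
    Δq≗0 : Δ Tg q ≗ zeroP
    Δq≗0 = Δ-φ-· Tg TR≗T y c (proj₂ (proj₂ (InSpan-ε⇒Δ φy∈E)))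

  ∣⇒multiple : ∀ {k} {p : Poly n} → (∀ i → k ∣ₛ p i) → ∃ λ q → p ≗ k · q
  ∣⇒multiple {k} k∣p = (λ i → _∣ₛ_.quotient (k∣p i)) ,
    λ i → trans (_∣ₛ_.equality (k∣p i)) (ℤₚ.*-comm (_∣ₛ_.quotient (k∣p i)) k)

  d-nonZero : NonZero d
  d-nonZero = >-nonZero (ℕₚ.<-≤-trans (s≤s z≤n) 2≤d)

  d₁-nonZero : NonZero d₁
  d₁-nonZero = ℕₚ.m*n≢0⇒m≢0 d₁ {{subst NonZero d≡d₁g d-nonZero}}

  -- Since `Δ h` multiplies φ y by d, `Δ h b` is d (φ y + `Δ h q`), and d cancels. Surjectivity is
  -- reduced to decomposing b in this way.
  Δ-divide : ∀ h → (∀ p → Lin n h (R p) ≗ Lin n h p) → ∀ {a b} y q →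
             (+ d) · a ≗ Δ h b → b ≗ φ y ⊕ ((+ d) · q) → a ⊖ φ y ≗ Δ h q
  Δ-divide h hR {a} {b} y q da≗Δb b≗ i = ℤₚ.*-cancelˡ-≡ (+ d) (a i - φ y i) (Δ h q i) {{d-nonZero}} (begin
    + d ℤ.* (a i - φ y i)            ≡⟨ lemma₁ (+ d) (a i) (φ y i) ⟩
    + d ℤ.* a i - + d ℤ.* φ y i      ≡⟨ cong (_- + d ℤ.* φ y i) (da≗Δb i) ⟩
    Δ h b i - + d ℤ.* φ y i          ≡⟨ cong (_- + d ℤ.* φ y i) (trans (Δ-cong h b≗ i) (Δ-⊕ h (φ y) ((+ d) · q) i)) ⟩
    Δ h (φ y) i ℤ.+ Δ h ((+ d) · q) i - + d ℤ.* φ y i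
      ≡⟨ cong₂ (λ u v → u ℤ.+ v - + d ℤ.* φ y i) (Δ-φ h hR y i) (Δ-· h (+ d) q i) ⟩
    + d ℤ.* φ y i ℤ.+ + d ℤ.* Δ h q i - + d ℤ.* φ y i
      ≡⟨ lemma₂ (+ d ℤ.* φ y i) (+ d ℤ.* Δ h q i) ⟩
    + d ℤ.* Δ h q i                  ∎)
    where
    lemma₁ : ∀ d a b → d ℤ.* (a - b) ≡ d ℤ.* a - d ℤ.* b
    lemma₁ = solve-∀
    lemma₂ : ∀ a b → a ℤ.+ b - a ≡ b
    lemma₂ = solve-∀

  -- The image of b under `Lin n h` is d b - `Δ h b` = d (b - a).
  d∣Lin : ∀ h {a b} → (+ d) · a ≗ Δ h b → ∀ i → + d ∣ₛ Lin n h b i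
  d∣Lin h {a} {b} da≗Δb i = divides (b i - a i) (begin
    Lin n h b i                            ≡⟨ lemma₁ (+ d ℤ.* b i) (Lin n h b i) ⟩
    + d ℤ.* b i - Δ h b i                  ≡⟨ cong (λ z → + d ℤ.* b i - z) (sym (da≗Δb i)) ⟩
    + d ℤ.* b i - + d ℤ.* a i              ≡⟨ lemma₂ (+ d) (b i) (a i) ⟩
    (b i - a i) ℤ.* + d                    ∎)
    where
    lemma₁ : ∀ x y → y ≡ x - (x - y)
    lemma₁ = solve-∀
    lemma₂ : ∀ d x y → d ℤ.* x - d ℤ.* y ≡ (x - y) ℤ.* d
    lemma₂ = solve-∀

  restrict-⊕ : ∀ p i → p i ≡ φ (p ∘ idx) i ℤ.+ R p i
  restrict-⊕ p i = trans (lemma (p i) (R p i)) (cong (ℤ._+ R p i) (φ-restrict p i))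
    where
    lemma : ∀ a b → a ≡ a - b ℤ.+ b
    lemma = solve-∀

  φ-surj-ε : ∀ a → InSpan n (ε n d) ((+ d) · a) → ∃ λ y → InSpan n (ε n d) (a ⊖ φ y)
  φ-surj-ε a da∈E = b ∘ idx , Δ⇒InSpan-ε q sum-q
    (Δ-divide Tg TR≗T (b ∘ idx) q da≗Δb (λ i → trans (restrict-⊕ b i) (cong (λ z → φ (b ∘ idx) i ℤ.+ z) (Rb≗dq i))))
    where
    b : Poly n
    b = proj₁ (InSpan-ε⇒Δ da∈E)
    sum-b : sum b ≡ 0ℤ
    sum-b = proj₁ (proj₂ (InSpan-ε⇒Δ da∈E))
    da≗Δb : (+ d) · a ≗ Δ Tg b
    da≗Δb = proj₂ (proj₂ (InSpan-ε⇒Δ da∈E))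
    -- Below n₁ the coefficients of R b occur among those of T b; from n₁ on they are zero.
    d∣Rb : ∀ i → + d ∣ₛ R b i
    d∣Rb i = case toℕ i ℕₚ.<? n₁ of λ where
      (yes i<n₁) → subst (+ d ∣ₛ_) (sym (R-< b i i<n₁)) (d∣Lin Tg da≗Δb ((d * toℕ i) mod n))
      (no i≮n₁)  → divides 0ℤ (R-≥ b i (ℕₚ.≮⇒≥ i≮n₁))
    q : Poly n
    q = proj₁ (∣⇒multiple d∣Rb)
    Rb≗dq : R b ≗ (+ d) · q
    Rb≗dq = proj₂ (∣⇒multiple d∣Rb)
    -- The ε-lattice is the image of 𝒵_n only, so q has to have coefficient sum zero; R preserves
    -- that sum.
    sum-q : sum q ≡ 0ℤ
    sum-q = ℤₚ.*-cancelˡ-≡ (+ d) (sum q) 0ℤ {{d-nonZero}} (begin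
      + d ℤ.* sum q       ≡⟨ *-distribˡ-sum (+ d) q ⟩
      sum ((+ d) · q)     ≡⟨ sum-cong-≗ (λ i → sym (Rb≗dq i)) ⟩
      sum (R b)           ≡⟨ sum-Lin-mono n (_% n₁) b ⟩
      sum b               ≡⟨ sum-b ⟩
      0ℤ                  ≡⟨ sym (ℤₚ.*-zeroʳ (+ d)) ⟩
      + d ℤ.* 0ℤ          ∎)

  P-≥ : ∀ i → n₁ ≤ toℕ i → P i ≡ 0ℤ
  P-≥ i n₁≤i = ℤₚ.*-cancelˡ-≡ (+ g) (P i) 0ℤ
    (trans (sym (R-𝟏 i)) (trans (R-≥ (𝟏 n) i n₁≤i) (sym (ℤₚ.*-zeroʳ (+ g)))))

  Δ-P : ∀ i → Δ Ug P i ≡ + d ℤ.* P i - + d₁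
  Δ-P i = cong (λ z → + d ℤ.* P i - z) (U-P i)

  Δ-𝟏 : ∀ i → Δ Ug (𝟏 n) i ≡ 0ℤ
  Δ-𝟏 i = trans (cong (λ z → + d ℤ.* 1ℤ - z) (U-𝟏 i)) (ℤₚ.i≡j⇒i-j≡0 {+ d ℤ.* 1ℤ} (ℤₚ.*-identityʳ (+ d)))

  -- T(x - 1)b = (x - 1)Ub is divisible by d, so all fibre sums of b are congruent modulo d.
  T-const-mod : ∀ b → (∀ i → + d ∣ₛ U b i) → ∀ k → + d ∣ₛ T b ((d * k) mod n) - T b (0 mod n)
  T-const-mod b d∣Ub zero = divides 0ℤ (trans
    (cong (λ m → T b (m mod n) - T b (0 mod n)) (ℕₚ.*-zeroʳ d)) (ℤₚ.+-inverseʳ (T b (0 mod n))))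
  T-const-mod b d∣Ub (suc k) = subst (+ d ∣ₛ_) eq (∣ₛ.∣m∣n⇒∣m-n (T-const-mod b d∣Ub k) d∣TSb)
    where
    w : Fin n
    w = (d + d * k) mod n
    d∣TSb : + d ∣ₛ T (S b) w
    d∣TSb = subst (+ d ∣ₛ_) (sym (TS≗SU b w)) (Lin-∣ n (shift n) d∣Ub w)
    lemma : ∀ x y c → x - c - (x - y) ≡ y - c
    lemma = solve-∀
    eq : T b ((d * k) mod n) - T b (0 mod n) - T (S b) w ≡ T b ((d * suc k) mod n) - T b (0 mod n)
    eq = begin
      T b ((d * k) mod n) - T b (0 mod n) - T (S b) w
        ≡⟨ cong (λ z → T b ((d * k) mod n) - T b (0 mod n) - z) (T-S b (d * k)) ⟩
      T b ((d * k) mod n) - T b (0 mod n) - (T b ((d * k) mod n) - T b w)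
        ≡⟨ lemma (T b ((d * k) mod n)) (T b w) (T b (0 mod n)) ⟩
      T b w - T b (0 mod n) ≡⟨ cong (λ m → T b (m mod n) - T b (0 mod n)) (sym (ℕₚ.*-suc d k)) ⟩
      T b ((d * suc k) mod n) - T b (0 mod n) ∎

  φ-surj-f : ∀ a → InSpan n (f n d) ((+ d) · a) → ∃ λ y → InSpan n (f n d) (a ⊖ φ y)
  φ-surj-f a da∈F = y , Δ⇒InSpan-f q (Δ-divide Ug UR≗U y q da≗Δb′ b′≗)
    where
    b : Poly n
    b = proj₁ (InSpan-f⇒Δ da∈F)
    da≗Δb : (+ d) · a ≗ Δ Ug b
    da≗Δb = proj₂ (InSpan-f⇒Δ da∈F)
    d∣Ub : ∀ i → + d ∣ₛ U b i
    d∣Ub = d∣Lin Ug da≗Δb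
    -- A representative of the common value modulo d of the sums of b over the classes modulo n₁.
    c : ℤ
    c = T b (0 mod n)
    d∣Rb-cP : ∀ i → + d ∣ₛ R b i - c ℤ.* P i
    d∣Rb-cP i = case toℕ i ℕₚ.<? n₁ of λ where
      (yes i<n₁) → subst (+ d ∣ₛ_)
        (cong₂ _-_ (sym (R-< b i i<n₁)) (trans (sym (ℤₚ.*-identityʳ c)) (cong (c ℤ.*_) (sym (P-< i i<n₁)))))
        (T-const-mod b d∣Ub (toℕ i))
      (no i≮n₁)  → divides 0ℤ
        (cong₂ _-_ (R-≥ b i (ℕₚ.≮⇒≥ i≮n₁)) (trans (cong (c ℤ.*_) (P-≥ i (ℕₚ.≮⇒≥ i≮n₁))) (ℤₚ.*-zeroʳ c)))
    q : Poly n
    q = proj₁ (∣⇒multiple d∣Rb-cP)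
    Rb-cP≗dq : R b ⊖ (c · P) ≗ (+ d) · q
    Rb-cP≗dq = proj₂ (∣⇒multiple d∣Rb-cP)
    U-Rb-cP : ∀ i → U b i - U (R b ⊖ (c · P)) i ≡ + d₁ ℤ.* c
    U-Rb-cP i = begin
      U b i - U (R b ⊖ (c · P)) i        ≡⟨ cong (λ z → U b i - z) (Lin-⊖ n Ug (R b) (c · P) i) ⟩
      U b i - (U (R b) i - U (c · P) i)
        ≡⟨ cong₂ (λ u v → U b i - (u - v)) (UR≗U b i) (trans (Lin-· n Ug c P i) (cong (c ℤ.*_) (U-P i))) ⟩
      U b i - (U b i - c ℤ.* + d₁)       ≡⟨ lemma (U b i) c (+ d₁) ⟩
      + d₁ ℤ.* c                         ∎
      where
      lemma : ∀ u c d → u - (u - c ℤ.* d) ≡ d ℤ.* c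
      lemma = solve-∀
    -- d = d₁ g divides U b and U(R b - c P), hence their difference d₁ c; then d₁ cancels.
    g∣c : + g ∣ₛ c
    g∣c = ∣ₛ.*-cancelˡ-∣ (+ d₁) {{d₁-nonZero}} (subst₂ _∣ₛ_ +d≡+d₁*+g (U-Rb-cP (0 mod n))
      (∣ₛ.∣m∣n⇒∣m-n (d∣Ub (0 mod n)) (Lin-∣ n Ug d∣Rb-cP (0 mod n))))
    s : ℤ
    s = _∣ₛ_.quotient g∣c
    y : Fin r → ℤ
    y j = b (idx j) - s ℤ.* 1ℤ
    b′ : Poly n
    -- Constants lie in the kernel of `Δ Ug`, and R takes s `𝟏` to s g P = c P. The shift therefore
    -- removes the part of R b that d need not divide.
    b′ = b ⊖ (s · 𝟏 n)
    da≗Δb′ : (+ d) · a ≗ Δ Ug b′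
    da≗Δb′ i = begin
      + d ℤ.* a i                     ≡⟨ da≗Δb i ⟩
      Δ Ug b i                        ≡⟨ sym (ℤₚ.+-identityʳ (Δ Ug b i)) ⟩
      Δ Ug b i - 0ℤ
        ≡⟨ cong (λ z → Δ Ug b i - z) (sym (trans (Δ-· Ug s (𝟏 n) i) (trans (cong (s ℤ.*_) (Δ-𝟏 i)) (ℤₚ.*-zeroʳ s)))) ⟩
      Δ Ug b i - Δ Ug (s · 𝟏 n) i     ≡⟨ sym (Δ-⊖ Ug b (s · 𝟏 n) i) ⟩
      Δ Ug b′ i                       ∎
    b′≗ : b′ ≗ φ y ⊕ ((+ d) · q)
    b′≗ i = begin
      b i - s ℤ.* 1ℤ ≡⟨ cong (_- s ℤ.* 1ℤ) (restrict-⊕ b i) ⟩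
      φ (b ∘ idx) i ℤ.+ R b i - s ℤ.* 1ℤ
        ≡⟨ lemma₁ (φ (b ∘ idx) i) (R b i) (c ℤ.* P i) s ⟩
      φ (b ∘ idx) i - s ℤ.* 1ℤ ℤ.+ c ℤ.* P i ℤ.+ (R b i - c ℤ.* P i)
        ≡⟨ cong₂ (λ u v → φ (b ∘ idx) i - s ℤ.* 1ℤ ℤ.+ u ℤ.* P i ℤ.+ v) (_∣ₛ_.equality g∣c) (Rb-cP≗dq i) ⟩
      φ (b ∘ idx) i - s ℤ.* 1ℤ ℤ.+ s ℤ.* + g ℤ.* P i ℤ.+ + d ℤ.* q i
        ≡⟨ lemma₂ (φ (b ∘ idx) i) s (+ g) (P i) (+ d ℤ.* q i) ⟩
      φ (b ∘ idx) i - s ℤ.* (1ℤ - + g ℤ.* P i) ℤ.+ + d ℤ.* q i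
        ≡⟨ cong (λ z → φ (b ∘ idx) i - z ℤ.+ + d ℤ.* q i)
             (sym (trans (φ-· s (λ _ → 1ℤ) i) (cong (s ℤ.*_) (φ-𝟏 i)))) ⟩
      φ (b ∘ idx) i - φ (λ _ → s ℤ.* 1ℤ) i ℤ.+ + d ℤ.* q i
        ≡⟨ cong (ℤ._+ + d ℤ.* q i) (sym (φ-⊖ (b ∘ idx) (λ _ → s ℤ.* 1ℤ) i)) ⟩
      φ y i ℤ.+ + d ℤ.* q i ∎
      where
      lemma₁ : ∀ a r x s → a ℤ.+ r - s ℤ.* 1ℤ ≡ a - s ℤ.* 1ℤ ℤ.+ x ℤ.+ (r - x)
      lemma₁ = solve-∀
      lemma₂ : ∀ a s g p x → a - s ℤ.* 1ℤ ℤ.+ s ℤ.* g ℤ.* p ℤ.+ x ≡ a - s ℤ.* (1ℤ - g ℤ.* p) ℤ.+ x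
      lemma₂ = solve-∀

  -- φ y - d c lies in the kernel of d - U, so it is a constant t; applying R shows d₁ ∣ t.
  φ-inj-f : ∀ y → InSpan n (f n d) (φ y) → ∃ λ t → + d₁ ∣ₛ t × ∀ j → + d ∣ₛ y j - t
  φ-inj-f y φy∈F = t , d₁∣t , λ j → divides (c (idx j)) (begin
    y j - t                               ≡⟨ cong₂ _-_ (sym (φ-idx y j)) (sym (q≗t (idx j))) ⟩
    φ y (idx j) - (φ y (idx j) - + d ℤ.* c (idx j)) ≡⟨ lemma₁ (φ y (idx j)) (+ d) (c (idx j)) ⟩
    c (idx j) ℤ.* + d                     ∎)
    where
    c : Poly n
    c = proj₁ (InSpan-f⇒Δ φy∈F)
    q : Poly n
    q = φ y ⊖ ((+ d) · c)
    t : ℤ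
    t = q (0 mod n)
    q≗t : ∀ i → q i ≡ t
    q≗t = U-eigen q (Δ-ker Ug q (Δ-φ-· Ug UR≗U y c (proj₂ (InSpan-f⇒Δ φy∈F))))
    lemma₁ : ∀ a d c → a - (a - d ℤ.* c) ≡ c ℤ.* d
    lemma₁ = solve-∀
    lemma₂ : ∀ d g x → 0ℤ - d ℤ.* g ℤ.* x ≡ g ℤ.* (ℤ.- x ℤ.* d)
    lemma₂ = solve-∀
    o : Fin n
    o = 0 mod n
    -- R kills φ y, so t g P = - d R c. At exponent 0, where P is 1, cancelling g leaves the factor
    -- d₁.
    d₁∣t : + d₁ ∣ₛ t
    d₁∣t = divides (ℤ.- R c o) (ℤₚ.*-cancelˡ-≡ (+ g) t (ℤ.- R c o ℤ.* + d₁) (begin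
      + g ℤ.* t                            ≡⟨ ℤₚ.*-comm (+ g) t ⟩
      t ℤ.* + g                            ≡⟨ cong (t ℤ.*_) (sym (ℤₚ.*-identityʳ (+ g))) ⟩
      t ℤ.* (+ g ℤ.* 1ℤ)                   ≡⟨ cong (λ z → t ℤ.* (+ g ℤ.* z)) (sym P-0) ⟩
      t ℤ.* (+ g ℤ.* P o)                  ≡⟨ cong (t ℤ.*_) (sym (R-𝟏 o)) ⟩
      t ℤ.* R (𝟏 n) o                      ≡⟨ sym (Lin-· n Rg t (𝟏 n) o) ⟩
      R (t · 𝟏 n) o                        ≡⟨ Lin-cong n Rg (λ i → trans (ℤₚ.*-identityʳ t) (sym (q≗t i))) o ⟩
      R q o                                ≡⟨ Lin-⊖ n Rg (φ y) ((+ d) · c) o ⟩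
      R (φ y) o - R ((+ d) · c) o          ≡⟨ cong₂ _-_ (φ-kernel Rg RR≗R y o) (Lin-· n Rg (+ d) c o) ⟩
      0ℤ - + d ℤ.* R c o                   ≡⟨ cong (λ z → 0ℤ - z ℤ.* R c o) +d≡+d₁*+g ⟩
      0ℤ - + d₁ ℤ.* + g ℤ.* R c o          ≡⟨ lemma₂ (+ d₁) (+ g) (R c o) ⟩
      + g ℤ.* (ℤ.- R c o ℤ.* + d₁)         ∎))

  -- Assembling the isomorphisms.

  0∈E : ∀ {a} → a ≗ zeroP → InSpan n (ε n d) a
  0∈E a≗0 = Δ⇒InSpan-ε zeroP (sum-replicate-zero n) (λ i → trans (a≗0 i) (sym (Δ-zero Tg i)))

  0∈F : ∀ {a} → a ≗ zeroP → InSpan n (f n d) a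
  0∈F a≗0 = Δ⇒InSpan-f zeroP (λ i → trans (a≗0 i) (sym (Δ-zero Ug i)))

  φ-addV : ∀ y z → φ (addV y z) ⊖ (φ y ⊕ φ z) ≗ zeroP
  φ-addV y z i = ℤₚ.i≡j⇒i-j≡0 {φ (addV y z) i} (φ-⊕ y z i)

  kerIso-ε : KerIso n d (ε n d) r (constMod r d)
  kerIso-ε = record
    { φ       = φ
    ; φ-inZ   = φ∈Z
    ; φ-inKer = d·φ∈E
    ; φ-wd    = λ x y x≡y → InSpan-resp (ε n d) (proj₂ (φ-cong-mod x y x≡y)) (d·φ∈E (proj₁ (φ-cong-mod x y x≡y)))
    ; φ-hom   = λ x y → 0∈E (φ-addV x y)
    ; φ-inj   = λ x y φx-φy∈E j → ∣ₛ.∣⇒∣ᵤ (φ-inj-ε (λ j → x j - y j) (InSpan-resp (ε n d) (φ-⊖ x y) φx-φy∈E) j)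
    ; φ-surj  = λ a _ → φ-surj-ε a
    }

  -- Without coordinates φ has the single value 0 up to pointwise equality, so surjectivity says
  -- that the kernel is trivial.
  kerIso-f-trivial : r ≡ 0 → KerIso n d (f n d) 0 (constMod 0 d)
  kerIso-f-trivial refl = record
    { φ       = φ
    ; φ-inZ   = φ∈Z
    ; φ-inKer = d·φ∈F
    ; φ-wd    = λ x y x≡y → InSpan-resp (f n d) (proj₂ (φ-cong-mod x y x≡y)) (d·φ∈F (proj₁ (φ-cong-mod x y x≡y)))
    ; φ-hom   = λ x y → 0∈F (φ-addV x y)
    ; φ-inj   = λ x y _ ()
    ; φ-surj  = λ a _ → φ-surj-f a
    }

-- In part (ii) the summand ℤ_{d₁} is generated by φ(-1, …, -1) = g P - 𝟏, since d₁ (g P - 𝟏) = (d - U) P;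
-- this change of coordinates takes the first basis vector to (-1, …, -1).
shear : ∀ {k} → (Fin (suc k) → ℤ) → Fin (suc k) → ℤ
shear x Fin.zero    = ℤ.- x Fin.zero
shear x (Fin.suc j) = x (Fin.suc j) - x Fin.zero

unshear : ∀ {k} → (Fin (suc k) → ℤ) → Fin (suc k) → ℤ
unshear y Fin.zero    = ℤ.- y Fin.zero
unshear y (Fin.suc j) = y (Fin.suc j) - y Fin.zero

shear-unshear : ∀ {k} (y : Fin (suc k) → ℤ) → shear (unshear y) ≗ y
shear-unshear y Fin.zero    = ℤₚ.neg-involutive (y Fin.zero)
shear-unshear y (Fin.suc j) = lemma (y (Fin.suc j)) (y Fin.zero)
  where
  lemma : ∀ a b → a - b - (ℤ.- b) ≡ a
  lemma = solve-∀

shear-addV : ∀ {k} (x y : Fin (suc k) → ℤ) → shear (addV x y) ≗ addV (shear x) (shear y)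
shear-addV x y Fin.zero    = ℤₚ.neg-distrib-+ (x Fin.zero) (y Fin.zero)
shear-addV x y (Fin.suc j) = lemma (x (Fin.suc j)) (y (Fin.suc j)) (x Fin.zero) (y Fin.zero)
  where
  lemma : ∀ a b c d → a ℤ.+ b - (c ℤ.+ d) ≡ a - c ℤ.+ (b - d)
  lemma = solve-∀

-- By `φ-inj-f`, φ y can vanish in the quotient only if y is congruent modulo d to a constant vector
-- (t, ..., t) with d₁ ∣ t. `shear` makes the constant direction a coordinate axis and so splits off
-- ℤ_{d₁}.
kerIso-f : ∀ n d n₁ d₁ g k .{{_ : NonZero n}} .{{_ : NonZero n₁}} .{{_ : NonZero g}} →
           2 ≤ d → n ≡ n₁ * g → d ≡ d₁ * g → Coprime n₁ d₁ → n₁ + suc k ≡ n →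
           KerIso n d (f n d) (suc k) (firstMod d₁ d k)
kerIso-f n d n₁ d₁ g k 2≤d n≡n₁g d≡d₁g coprime n₁+r≡n = record
  { φ       = φ ∘ shear
  ; φ-inZ   = φ∈Z ∘ shear
  ; φ-inKer = d·φ∈F ∘ shear
  ; φ-wd    = well-defined
  ; φ-hom   = λ x y → 0∈F (λ i → trans
      (cong (_- (φ (shear x) i ℤ.+ φ (shear y) i)) (φ-cong (shear-addV x y) i))
      (φ-addV (shear x) (shear y) i))
  ; φ-inj   = injective
  ; φ-surj  = λ a _ da∈F → let y , a-φy∈F = φ-surj-f a da∈F in
      unshear y , InSpan-resp (f n d) (λ i → cong (λ z → a i - z) (φ-cong (shear-unshear y) i)) a-φy∈F
  }
  where
  open DeBruijn n d n₁ d₁ g (suc k) 2≤d n≡n₁g d≡d₁g coprime n₁+r≡n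

  well-defined : ∀ x y → CongMod (firstMod d₁ d k) x y → InSpan n (f n d) (φ (shear x) ⊖ φ (shear y))
  -- φ z accounts for the multiples of d, and s P for the first coordinate, because `Δ Ug P` = d₁ (g
  -- P - `𝟏`).
  well-defined x y x≡y = Δ⇒InSpan-f (φ z ⊕ (s · P)) (λ i → begin
    φ (shear x) i - φ (shear y) i         ≡⟨ sym (φ-⊖ (shear x) (shear y) i) ⟩
    φ (λ j → shear x j - shear y j) i     ≡⟨ φ-cong shear-x-y i ⟩
    φ (λ j → + d ℤ.* z j - s ℤ.* + d₁ ℤ.* 1ℤ) i
      ≡⟨ φ-⊖ (λ j → + d ℤ.* z j) (λ _ → s ℤ.* + d₁ ℤ.* 1ℤ) i ⟩
    φ (λ j → + d ℤ.* z j) i - φ (λ _ → s ℤ.* + d₁ ℤ.* 1ℤ) i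
      ≡⟨ cong₂ _-_ (φ-· (+ d) z i)
           (trans (φ-· (s ℤ.* + d₁) (λ _ → 1ℤ) i) (cong (s ℤ.* + d₁ ℤ.*_) (φ-𝟏 i))) ⟩
    + d ℤ.* φ z i - s ℤ.* + d₁ ℤ.* (1ℤ - + g ℤ.* P i)
      ≡⟨ lemma (+ d ℤ.* φ z i) s (+ d₁) (+ g) (P i) ⟩
    + d ℤ.* φ z i ℤ.+ s ℤ.* (+ d₁ ℤ.* + g ℤ.* P i - + d₁)
      ≡⟨ cong (λ e → + d ℤ.* φ z i ℤ.+ s ℤ.* (e ℤ.* P i - + d₁)) (sym +d≡+d₁*+g) ⟩
    + d ℤ.* φ z i ℤ.+ s ℤ.* (+ d ℤ.* P i - + d₁)
      ≡⟨ cong₂ ℤ._+_ (sym (Δ-φ Ug UR≗U z i))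
           (trans (cong (s ℤ.*_) (sym (Δ-P i))) (sym (Δ-· Ug s P i))) ⟩
    Δ Ug (φ z) i ℤ.+ Δ Ug (s · P) i       ≡⟨ sym (Δ-⊕ Ug (φ z) (s · P) i) ⟩
    Δ Ug (φ z ⊕ (s · P)) i                ∎)
    where
    d₁∣ : + d₁ ∣ₛ x Fin.zero - y Fin.zero
    d₁∣ = ∣ₛ.∣ᵤ⇒∣ (x≡y Fin.zero)
    d∣ : ∀ j → + d ∣ₛ x (Fin.suc j) - y (Fin.suc j)
    d∣ j = ∣ₛ.∣ᵤ⇒∣ (x≡y (Fin.suc j))
    s : ℤ
    s = _∣ₛ_.quotient d₁∣
    z : Fin (suc k) → ℤ
    -- The difference in the first coordinate is carried entirely by s.
    z Fin.zero    = 0ℤ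
    z (Fin.suc j) = _∣ₛ_.quotient (d∣ j)
    lemma : ∀ a s d g p → a - s ℤ.* d ℤ.* (1ℤ - g ℤ.* p) ≡ a ℤ.+ s ℤ.* (d ℤ.* g ℤ.* p - d)
    lemma = solve-∀
    lemma₀ : ∀ a b → ℤ.- a - (ℤ.- b) ≡ ℤ.- (a - b)
    lemma₀ = solve-∀
    lemma₀′ : ∀ d s → ℤ.- s ≡ d ℤ.* 0ℤ - s ℤ.* 1ℤ
    lemma₀′ = solve-∀
    lemmaₛ : ∀ a b a₀ b₀ → a - a₀ - (b - b₀) ≡ a - b - (a₀ - b₀)
    lemmaₛ = solve-∀
    lemmaₛ′ : ∀ q d s → q ℤ.* d - s ≡ d ℤ.* q - s ℤ.* 1ℤ
    lemmaₛ′ = solve-∀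
    shear-x-y : ∀ j → shear x j - shear y j ≡ + d ℤ.* z j - s ℤ.* + d₁ ℤ.* 1ℤ
    shear-x-y Fin.zero = begin
      ℤ.- x Fin.zero - (ℤ.- y Fin.zero)   ≡⟨ lemma₀ (x Fin.zero) (y Fin.zero) ⟩
      ℤ.- (x Fin.zero - y Fin.zero)       ≡⟨ cong ℤ.-_ (_∣ₛ_.equality d₁∣) ⟩
      ℤ.- (s ℤ.* + d₁)                    ≡⟨ lemma₀′ (+ d) (s ℤ.* + d₁) ⟩
      + d ℤ.* 0ℤ - s ℤ.* + d₁ ℤ.* 1ℤ      ∎
    shear-x-y (Fin.suc j) = begin
      x (Fin.suc j) - x Fin.zero - (y (Fin.suc j) - y Fin.zero)
        ≡⟨ lemmaₛ (x (Fin.suc j)) (y (Fin.suc j)) (x Fin.zero) (y Fin.zero) ⟩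
      x (Fin.suc j) - y (Fin.suc j) - (x Fin.zero - y Fin.zero)
        ≡⟨ cong₂ _-_ (_∣ₛ_.equality (d∣ j)) (_∣ₛ_.equality d₁∣) ⟩
      z (Fin.suc j) ℤ.* + d - s ℤ.* + d₁  ≡⟨ lemmaₛ′ (z (Fin.suc j)) (+ d) (s ℤ.* + d₁) ⟩
      + d ℤ.* z (Fin.suc j) - s ℤ.* + d₁ ℤ.* 1ℤ ∎

  d₁∣d : + d₁ ∣ₛ + d
  d₁∣d = divides (+ g) (trans +d≡+d₁*+g (ℤₚ.*-comm (+ d₁) (+ g)))

  injective : ∀ x y → InSpan n (f n d) (φ (shear x) ⊖ φ (shear y)) → CongMod (firstMod d₁ d k) x y
  injective x y φx-φy∈F j = ∣ₛ.∣⇒∣ᵤ (go j)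
    where
    w : Fin (suc k) → ℤ
    w j = shear x j - shear y j
    w-inj : ∃ λ t → + d₁ ∣ₛ t × ∀ j → + d ∣ₛ w j - t
    w-inj = φ-inj-f w (InSpan-resp (f n d) (φ-⊖ (shear x) (shear y)) φx-φy∈F)
    t : ℤ
    t = proj₁ w-inj
    d∣w-t : ∀ j → + d ∣ₛ w j - t
    d∣w-t = proj₂ (proj₂ w-inj)
    lemma₀ : ∀ a b t → ℤ.- (ℤ.- a - (ℤ.- b) - t ℤ.+ t) ≡ a - b
    lemma₀ = solve-∀
    lemmaₛ : ∀ a b a₀ b₀ t → a - a₀ - (b - b₀) - t - (ℤ.- a₀ - (ℤ.- b₀) - t) ≡ a - b
    lemmaₛ = solve-∀
    go : ∀ j → + firstMod d₁ d k j ∣ₛ x j - y j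
    -- Here w₀ = -(x₀ - y₀), and d₁ divides both w₀ - t and t.
    go Fin.zero = subst (+ d₁ ∣ₛ_) (lemma₀ (x Fin.zero) (y Fin.zero) t)
      (∣ₛ.∣m⇒∣-m (∣ₛ.∣m∣n⇒∣m+n (∣ₛ.∣-trans d₁∣d (d∣w-t Fin.zero)) (proj₁ (proj₂ w-inj))))
    -- Subtracting the congruence at index 0 removes t together with the x₀ - y₀ mixed in by
    -- `shear`.
    go (Fin.suc j) = subst (+ d ∣ₛ_) (lemmaₛ (x (Fin.suc j)) (y (Fin.suc j)) (x Fin.zero) (y Fin.zero) t)
      (∣ₛ.∣m∣n⇒∣m-n (d∣w-t (Fin.suc j)) (d∣w-t Fin.zero))

-- Specialisation to g = gcd(n, d).

-- Multiplying gcd(n₁, d₁) by g gives gcd(n, d) = g, and g cancels.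
coprime-quotients : ∀ n d n₁ d₁ .{{_ : NonZero (gcd n d)}} →
                    n ≡ n₁ * gcd n d → d ≡ d₁ * gcd n d → Coprime n₁ d₁
coprime-quotients n d n₁ d₁ n≡ d≡ = gcd≡1⇒coprime (ℕₚ.*-cancelˡ-≡ (gcd n₁ d₁) 1 g (begin
  g * gcd n₁ d₁         ≡⟨ c*gcd[m,n]≡gcd[cm,cn] g n₁ d₁ ⟩
  gcd (g * n₁) (g * d₁) ≡⟨ cong₂ gcd (trans (ℕₚ.*-comm g n₁) (sym n≡)) (trans (ℕₚ.*-comm g d₁) (sym d≡)) ⟩
  g                     ≡⟨ sym (ℕₚ.*-identityʳ g) ⟩
  g * 1                 ∎))
  where
  g : ℕ
  g = gcd n d

theorem4p2 : (n : ℕ) .{{_ : NonZero n}} (d : ℕ) → 2 ≤ d →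
    (n₁ d₁ : ℕ) → n ≡ n₁ * gcd n d → d ≡ d₁ * gcd n d →
    KerIso n d (ε n d) (n ∸ n₁) (constMod (n ∸ n₁) d)
    × (1 < gcd n d → KerIso n d (f n d) (suc (n ∸ n₁ ∸ 1)) (firstMod d₁ d (n ∸ n₁ ∸ 1)))
    × (gcd n d ≡ 1 → KerIso n d (f n d) 0 (constMod 0 d))
theorem4p2 n d 2≤d n₁ d₁ n≡n₁g d≡d₁g =
    DeBruijn.kerIso-ε n d n₁ d₁ (gcd n d) (n ∸ n₁) 2≤d n≡n₁g d≡d₁g n₁⊥d₁ (ℕₚ.m+[n∸m]≡n n₁≤n)
  , (λ 1<g → kerIso-f n d n₁ d₁ (gcd n d) (n ∸ n₁ ∸ 1) 2≤d n≡n₁g d≡d₁g n₁⊥d₁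
      -- A gcd above 1 makes n₁ < n, so the subtraction of 1 is not truncated.
      (trans (cong (λ z → n₁ + z) (ℕₚ.m+[n∸m]≡n (ℕₚ.m<n⇒0<n∸m (n₁<n 1<g)))) (ℕₚ.m+[n∸m]≡n n₁≤n)))
  , (λ g≡1 → DeBruijn.kerIso-f-trivial n d n₁ d₁ (gcd n d) 0 2≤d n≡n₁g d≡d₁g n₁⊥d₁
      (trans (ℕₚ.+-identityʳ n₁) (trans (sym (ℕₚ.*-identityʳ n₁)) (trans (cong (n₁ *_) (sym g≡1)) (sym n≡n₁g)))) refl)
  where
  n₁g-nonZero : NonZero (n₁ * gcd n d)
  n₁g-nonZero = subst NonZero n≡n₁g (≢-nonZero (≢-nonZero⁻¹ n))
  instance
    n₁-nonZero : NonZero n₁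
    n₁-nonZero = ℕₚ.m*n≢0⇒m≢0 n₁ {{n₁g-nonZero}}
    g-nonZero : NonZero (gcd n d)
    g-nonZero = ℕₚ.m*n≢0⇒n≢0 n₁ {{n₁g-nonZero}}
  n₁⊥d₁ : Coprime n₁ d₁
  n₁⊥d₁ = coprime-quotients n d n₁ d₁ n≡n₁g d≡d₁g
  n₁≤n : n₁ ≤ n
  n₁≤n = subst (n₁ ≤_) (sym n≡n₁g) (ℕₚ.m≤m*n n₁ (gcd n d))
  n₁<n : 1 < gcd n d → n₁ < n
  n₁<n 1<g = subst (n₁ <_) (sym n≡n₁g) (ℕₚ.m<m*n n₁ (gcd n d) 1<g)
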